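{- Let $m$ be a constant. The functions sending $$(1^n\,0\,0\,1^{\alpha_1}\,0\,1^{\alpha_2}\,0\,\cdots\,0\,1^{\alpha_n}\,0\,0\,1^{\beta_1}\,0\,\cdots\,0\,1^{\beta_m})$$ to $\#CT(\alpha,\beta)$ and to $\#CT_0(\alpha,\beta)$, respectively, are in $\#\mathsf{L}$. (Here $n$ is not fixed.)
   Context: Let $\alpha=(\alpha_1,\dots,\alpha_n)$ and $\beta=(\beta_1,\dots,\beta_m)$ be compositions (finite sequences of positive integers) of the same integer. $CT(\alpha,\beta)$ is the set of contingency tables with marginals $\alpha,\beta$: $n\times m$ matrices $A$ with entries in $\mathbb{N}_0$ such that $\sum_i A_{ij}=\beta_j$ for $j=1,\dots,m$ and $\sum_j A_{ij}=\alpha_i$ for $i=1,\dots,n$. $CT_0(\alpha,\beta)$ is the subset of those with all entries in $\{0,1\}$. The alphabet is $\Sigma=\{0,1\}$; $1^a$ is the string of $a$ ones and juxtaposition is concatenation. A function given only on strings of a specified form is extended by $0$ to all other strings. $\#\mathsf{L}$ is the class of functions $f:\Sigma^*\to\mathbb{N}_0$ such that $f(x)$ is the number of accepting computation paths on input $x$ of a fixed nondeterministic Turing machine with read-only input tape that uses $O(\log|x|)$ work space and halts on every computation path. Equivalently: there are a polynomial $q$ and a deterministic $O(\log|x|)$-space Turing machine $M$ with an additional read-once, left-to-right witness tape such that $f(x)=\#\{w\in\Sigma^{q(|x|)}\mid M(x,w)=\mathsf{yes}\}$. -}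

module Defs where

open import Data.Bool.Base using (Bool; true; false; T)
open import Data.Fin.Base using (Fin)
open import Data.List.Base using (List; []; _∷_; _++_; length; replicate; intercalate)
open import Data.Nat.Base using (ℕ; _+_; _*_; _≤_)
open import Data.Nat.Logarithm using (⌊log₂_⌋)
open import Data.Product.Base using (Σ-syntax; ∃-syntax; _×_)
open import Data.Sum.Base using (_⊎_)
open import Data.Vec.Base using (Vec)
open import Data.Vec.Relation.Unary.All using (All)
open import Function.Base using (flip)
open import Function.Bundles using (_↔_)
open import Induction.WellFounded using (Acc)
open import Relation.Binary.Construct.Closure.ReflexiveTransitive using (Star)
open import Relation.Binary.PropositionalEquality using (_≡_; _≢_)
open import Relation.Nullary.Negation.Core using (¬_)
import Data.List.Base as List
import Data.Vec.Base as Vec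

HasCardinality : Set → ℕ → Set
HasCardinality A k = A ↔ Fin k

-- The alphabet {0,1}, with 0 = false and 1 = true.
Word : Set
Word = List Bool

data Direction : Set where
  left stay right : Direction

-- A tape with its head; the cells to the left are listed from the head
-- outwards.  On a work tape exactly the cells visited so far are listed,
-- all cells beyond them being blank.
record Tape (A : Set) : Set where
  constructor tape
  field
    before : List A
    head   : A
    after  : List A

open Tape public

cells : {A : Set} → Tape A → ℕ
cells t = length (before t) + 1 + length (after t)

write : {A : Set} → A → Tape A → Tape A
write a t = record t { head = a }

-- Work tapes are infinite in both directions.
moveWork : {A : Set} → A → Direction → Tape A → Tape A
moveWork blank left  (tape []       h rs)       = tape [] blank (h ∷ rs)
moveWork blank left  (tape (l ∷ ls) h rs)       = tape ls l (h ∷ rs)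
moveWork blank stay  t                          = t
moveWork blank right (tape ls       h [])       = tape (h ∷ ls) blank []
moveWork blank right (tape ls       h (r ∷ rs)) = tape (h ∷ ls) r rs

data InputSymbol : Set where
  leftEnd rightEnd : InputSymbol
  bit              : Bool → InputSymbol

inputTape : Word → Tape InputSymbol
inputTape x = tape [] leftEnd (List.map bit x ++ rightEnd ∷ [])

-- The input head cannot leave the input and its two end markers; a move
-- beyond them leaves it where it is.
moveInput : Direction → Tape InputSymbol → Tape InputSymbol
moveInput left  (tape []       h rs)       = tape [] h rs
moveInput left  (tape (l ∷ ls) h rs)       = tape ls l (h ∷ rs)
moveInput stay  t                          = t
moveInput right (tape ls       h [])       = tape ls h []
moveInput right (tape ls       h (r ∷ rs)) = tape (h ∷ ls) r rs

record Action (State Γ : Set) (tapes : ℕ) : Set where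
  constructor action
  field
    nextState  : State
    inputMove  : Direction
    written    : Vec Γ tapes
    workMoves  : Vec Direction tapes

record Configuration (State Γ : Set) (tapes : ℕ) : Set where
  constructor config
  field
    state : State
    input : Tape InputSymbol
    work  : Vec (Tape Γ) tapes

open Configuration public

-- A nondeterministic Turing machine with a read-only input tape and finitely
-- many work tapes.  The transition relation is the set of those
-- (state , input symbol , work symbols , action) which δ maps to true.
-- A configuration is halting when no action is allowed in it.
record NTM : Set₁ where
  field
    State        : Set
    stateCount   : ℕ
    finiteState  : HasCardinality State stateCount
    Γ            : Set
    symbolCount  : ℕ
    finiteΓ      : HasCardinality Γ symbolCount
    blank        : Γ
    tapes        : ℕ
    start accept : State
    δ            : State → InputSymbol → Vec Γ tapes → Action State Γ tapes → Bool
    acceptHalts  : ∀ s γs a → ¬ T (δ accept s γs a)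

module Computation (M : NTM) where
  open NTM M

  Config : Set
  Config = Configuration State Γ tapes

  initial : Word → Config
  initial x = config start (inputTape x) (Vec.replicate tapes (tape [] blank []))

  allowed : Config → Action State Γ tapes → Bool
  allowed c = δ (state c) (head (input c)) (Vec.map head (work c))

  perform : Action State Γ tapes → Config → Config
  perform (action q d γs ds) (config _ i ws) =
    config q (moveInput d i)
      (Vec.zipWith (moveWork blank) ds (Vec.zipWith write γs ws))

  data _⟶_ (c : Config) : Config → Set where
    step : ∀ a → T (allowed c a) → c ⟶ perform a c

  _⟶*_ : Config → Config → Set
  _⟶*_ = Star _⟶_

  AcceptingPath : Word → Set
  AcceptingPath x = ∃[ c ] (initial x ⟶* c) × state c ≡ accept

  -- Accessibility for the reversed step relation: no computation path
  -- starting from the initial configuration is infinite.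
  HaltsOnEveryPath : Word → Set
  HaltsOnEveryPath x = Acc (flip _⟶_) (initial x)

  workSpace : Config → ℕ
  workSpace c = Vec.sum (Vec.map cells (work c))

  RunsInLogSpace : Set
  RunsInLogSpace =
    ∃[ k ] ∃[ N ] ∀ x → N ≤ length x →
      ∀ c → initial x ⟶* c → workSpace c ≤ k * ⌊log₂ length x ⌋

infix 4 _∈#L

record _∈#L (f : Word → ℕ) : Set₁ where
  field
    machine : NTM
  open Computation machine
  field
    logSpace : RunsInLogSpace
    halts    : ∀ x → HaltsOnEveryPath x
    counts   : ∀ x → HasCardinality (AcceptingPath x) (f x)

Matrix : ℕ → ℕ → Set
Matrix n m = Vec (Vec ℕ m) n

record CT {n m : ℕ} (α : Vec ℕ n) (β : Vec ℕ m) : Set where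
  constructor table
  field
    entries    : Matrix n m
    rowSums    : Vec.map Vec.sum entries ≡ α
    columnSums : Vec.map Vec.sum (Vec.transpose entries) ≡ β

CT₀ : {n m : ℕ} → Vec ℕ n → Vec ℕ m → Set
CT₀ α β = Σ[ A ∈ CT α β ] All (All (λ a → a ≡ 0 ⊎ a ≡ 1)) (CT.entries A)

record Marginals (m : ℕ) : Set where
  field
    {n}       : ℕ
    α         : Vec ℕ n
    β         : Vec ℕ m
    αPositive : All (1 ≤_) α
    βPositive : All (1 ≤_) β
    sameSum   : Vec.sum α ≡ Vec.sum β

ones : ℕ → Word
ones a = replicate a true

unary : {n : ℕ} → Vec ℕ n → Word
unary α = intercalate (false ∷ []) (List.map ones (Vec.toList α))

encode : {m : ℕ} → Marginals m → Word
encode M = ones n ++ false ∷ false ∷ unary α ++ false ∷ false ∷ unary β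
  where open Marginals M

-- f sends the encoding of (α , β) to the cardinality of S α β, and every word
-- that is not such an encoding to 0.  These conditions determine f: since all
-- parts are positive, encode is injective.
record Counts (m : ℕ) (S : ∀ {n} → Vec ℕ n → Vec ℕ m → Set) (f : Word → ℕ) : Set where
  field
    onEncodings : ∀ (M : Marginals m) →
                  HasCardinality (S (Marginals.α M) (Marginals.β M)) (f (encode M))
    elsewhere   : ∀ x → (∀ (M : Marginals m) → x ≢ encode M) → f x ≡ 0

module Submission where

-- A word is scanned once from left to right by a machine with 1 + m counters.
-- While reading the row sum 1^a of a row, the machine assigns each 1 to one of
-- the m columns, in nondecreasing order of columns for arbitrary entries and in
-- strictly increasing order for entries 0 and 1, and increments the counter of
-- the chosen column.  The ordered assignments of the a ones of a row correspond
-- to the rows with sum a, each row arising exactly once (row-suc): the first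
-- chosen column is the first nonzero column of the row.  An extra counter first
-- counts up to n and is decremented at the end of each row, so it checks the
-- number of rows.  When 1^b is read for the j-th column sum, the counter of
-- column j is decremented, and it must reach zero exactly at the end of this
-- block.  Hence the accepting runs on the encoding of (α , β) correspond to the
-- contingency tables (run-encode-↔, Contingency-↔), and a word that is no
-- encoding has no accepting run (sound).
--
-- This process is a real-time counter automaton: each input symbol causes at
-- most one increment, decrement or zero test.  Every counter automaton of this
-- kind is simulated in logarithmic space by a Turing machine that keeps each
-- counter in binary on a work tape of its own (module Compile).  The operations
-- on numerals are deterministic, so the accepting paths of the Turing machine
-- correspond to the accepting runs of the automaton (behaves-initial).  No
-- counter exceeds 1 + |x|, so the numerals have O(log |x|) digits.
--
-- Termination, the space bound and the number of accepting paths are established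
-- together, for one configuration at a time, by the predicate Behaves.

open import Defs
open import Axiom.UniquenessOfIdentityProofs.WithK using (uip)
open import Data.Bool.Base using (Bool; true; false; T; if_then_else_)
open import Data.Bool.Properties using (T-irrelevant)
open import Data.Empty using (⊥)
open import Data.Fin.Base as Fin using (Fin; zero; suc; inject₁; fromℕ)
open import Data.Fin.Patterns using (0F; 1F; 2F; 3F; 4F)
open import Data.Fin.Properties as Fin using (0↔⊥; 1↔⊤; 2↔Bool; +↔⊎)
open import Data.Fin.Relation.Unary.Top using (view; ‵fromℕ; ‵inject₁)
open import Data.List.Base as List using (List; []; _∷_; _++_; length; _ʳ++_)
import Data.List.Properties as List
open import Data.List.Relation.Unary.All as ListAll using ([]; _∷_)
open import Data.Maybe.Base as Maybe using (Maybe; nothing; just; maybe′)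
import Data.Maybe.Properties as Maybe
open import Data.Nat.Base using (ℕ; zero; suc; _+_; _*_; _^_; _≤_; z≤n; s≤s)
open import Data.Nat.Logarithm
open import Data.Nat.Properties
open import Data.Product.Base using (Σ; Σ-syntax; ∃-syntax; _×_; _,_; proj₁; proj₂)
open import Data.Product.Function.Dependent.Propositional using (Σ-↔)
import Data.Product.Properties as Product
open import Data.Sum.Base using (_⊎_; inj₁; inj₂)
open import Data.Sum.Function.Propositional using (_⊎-↔_)
open import Data.Unit.Base using (⊤; tt)
open import Data.Vec.Base as Vec using (Vec; []; _∷_; lookup; _[_]≔_; replicate; zipWith; sum)
import Data.Vec.Properties as Vec
open import Data.Vec.Relation.Unary.All as All using (All; []; _∷_)
import Data.Vec.Relation.Unary.All.Properties as All
open import Function.Base using (flip; _∘_; id)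
open import Function.Bundles using (_↔_; mk↔ₛ′; mk↣; Inverse)
open import Function.Construct.Composition using (_↔-∘_)
open import Function.Construct.Identity using (↔-id)
open import Function.Construct.Symmetry using (↔-sym)
open import Function.Properties.Inverse using (↔⇒↣)
open import Function.Related.Propositional using (≡⇒)
open import Function.Related.TypeIsomorphisms using (Σ-assoc)
open import Induction.WellFounded using (Acc; acc)
open import Relation.Binary.Construct.Closure.ReflexiveTransitive using (ε; _◅_)
open import Relation.Binary.Definitions using (DecidableEquality)
open import Relation.Binary.PropositionalEquality
open import Relation.Nullary.Decidable using (⌊_⌋; toWitness; fromWitness; via-injection; yes; no)
open import Relation.Nullary.Negation.Core using (¬_; contradiction)

open Inverse using (to; from; strictlyInverseˡ)

-- Finite sets

-- A set is finite if it has some cardinality; the cardinality is part of the data.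
Finite : Set → Set
Finite A = ∃[ k ] HasCardinality A k

finite-↔ : {A B : Set} → A ↔ B → Finite B → Finite A
finite-↔ A↔B (k , B↔k) = k , (B↔k ↔-∘ A↔B)

finite-⊥ : Finite ⊥
finite-⊥ = 0 , ↔-sym 0↔⊥

finite-⊤ : Finite ⊤
finite-⊤ = 1 , ↔-sym 1↔⊤

finite-Bool : Finite Bool
finite-Bool = 2 , ↔-sym 2↔Bool

finite-Fin : ∀ k → Finite (Fin k)
finite-Fin k = k , ↔-id _

finite-T : ∀ b → Finite (T b)
finite-T true  = finite-⊤
finite-T false = finite-⊥

finite-⊎ : {A B : Set} → Finite A → Finite B → Finite (A ⊎ B)
finite-⊎ (k , A↔k) (l , B↔l) = k + l , (↔-sym +↔⊎ ↔-∘ (A↔k ⊎-↔ B↔l))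

finite-Maybe : {A : Set} → Finite A → Finite (Maybe A)
finite-Maybe {A} A-fin = finite-↔ Maybe↔⊤⊎ (finite-⊎ finite-⊤ A-fin)
  where
  Maybe↔⊤⊎ : Maybe A ↔ (⊤ ⊎ A)
  Maybe↔⊤⊎ = mk↔ₛ′ (maybe′ inj₂ (inj₁ tt))
    (λ { (inj₁ _) → nothing ; (inj₂ a) → just a })
    (λ { (inj₁ _) → refl ; (inj₂ _) → refl })
    (λ { nothing → refl ; (just _) → refl })

finite-ΣFin : ∀ k {A : Fin k → Set} → (∀ i → Finite (A i)) → Finite (Σ (Fin k) A)
finite-ΣFin zero    A-fin = finite-↔ (mk↔ₛ′ (λ ()) (λ ()) (λ ()) (λ ())) finite-⊥
finite-ΣFin (suc k) {A} A-fin =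
  finite-↔ split (finite-⊎ (A-fin zero) (finite-ΣFin k (A-fin ∘ suc)))
  where
  split : Σ (Fin (suc k)) A ↔ (A zero ⊎ Σ (Fin k) (A ∘ suc))
  split = mk↔ₛ′
    (λ { (zero , a) → inj₁ a ; (suc i , a) → inj₂ (i , a) })
    (λ { (inj₁ a) → zero , a ; (inj₂ (i , a)) → suc i , a })
    (λ { (inj₁ _) → refl ; (inj₂ _) → refl })
    (λ { (zero , _) → refl ; (suc _ , _) → refl })

finite-Σ : {A : Set} {B : A → Set} → Finite A → (∀ a → Finite (B a)) → Finite (Σ A B)
finite-Σ {B = B} (k , A↔k) B-fin =
  finite-↔ (↔-sym (Σ-↔ (↔-sym A↔k) (↔-id _))) (finite-ΣFin k (λ i → B-fin (from A↔k i)))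

finite-≟ : {A : Set} → Finite A → DecidableEquality A
finite-≟ (_ , A↔k) = via-injection (↔⇒↣ A↔k) Fin._≟_

-- Two propositions that imply one another are in bijection.
prop-↔ : {A B : Set} → (∀ (x y : A) → x ≡ y) → (∀ (x y : B) → x ≡ y) →
         (A → B) → (B → A) → A ↔ B
prop-↔ A-prop B-prop f g = mk↔ₛ′ f g (λ _ → B-prop _ _) (λ _ → A-prop _ _)

both-empty : {A B : Set} → ¬ A → ¬ B → A ↔ B
both-empty ¬a ¬b = mk↔ₛ′ (λ a → contradiction a ¬a) (λ b → contradiction b ¬b)
  (λ b → contradiction b ¬b) (λ a → contradiction a ¬a)

-- A sum over the elements satisfying a Boolean predicate that singles out a
-- is the summand at a.
unique-↔ : {A : Set} (p : A → Bool) {B : A → Set} (a : A) → T (p a) → (∀ a′ → T (p a′) → a ≡ a′) →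
           (Σ[ a′ ∈ A ] T (p a′) × B a′) ↔ B a
unique-↔ {A} p {B} a ok unique = mk↔ₛ′
  (λ (a′ , ok′ , y) → subst B (sym (unique a′ ok′)) y)
  (λ y → a , ok , y)
  (λ y → cong (λ e → subst B e y) (uip (sym (unique a ok)) refl))
  (λ (a′ , ok′ , y) → same (unique a′ ok′) ok′ y)
  where
  same : ∀ {a′} (e : a ≡ a′) (ok′ : T (p a′)) (y : B a′) →
         _≡_ {A = Σ[ a′ ∈ A ] T (p a′) × B a′} (a , ok , subst B (sym e) y) (a′ , ok′ , y)
  same refl ok′ y = cong (λ ok → a , ok , y) (T-irrelevant ok ok′)

-- Computation trees

module Trees (M : NTM) where
  open NTM M
  open Computation M

  -- The accepting computation paths from an arbitrary configuration.
  AcceptingFrom : Config → Set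
  AcceptingFrom c = ∃[ c′ ] (c ⟶* c′) × state c′ ≡ accept

  -- Every work tape has at most b cells.
  Fits : ℕ → Vec (Tape Γ) tapes → Set
  Fits b ws = ∀ t → cells (lookup ws t) ≤ b

  -- All paths from c end, no configuration on them uses more than b cells of any
  -- work tape, and the accepting ones correspond to the elements of A.
  record Behaves (b : ℕ) (c : Config) (A : Set) : Set where
    field
      halts  : Acc (flip _⟶_) c
      fits   : ∀ c′ → c ⟶* c′ → Fits b (work c′)
      counts : AcceptingFrom c ↔ A

  open Behaves

  behaves-accept : ∀ {b c} → state c ≡ accept → Fits b (work c) → Behaves b c ⊤
  behaves-accept {b} {c} accepting c-fits = record
    { halts  = acc λ { (step a ok) → contradiction ok (stuck a) }
    ; fits   = λ { _ ε → c-fits ; _ (step a ok ◅ _) → contradiction ok (stuck a) }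
    ; counts = mk↔ₛ′ _ (λ _ → c , ε , accepting) (λ _ → refl) λ
        { (_ , ε , e) → cong (λ e → c , ε , e) (uip accepting e)
        ; (_ , step a ok ◅ _ , _) → contradiction ok (stuck a) }
    }
    where
    stuck : ∀ a → ¬ T (allowed c a)
    stuck a rewrite accepting = acceptHalts _ _ a

  -- The lemmas on Behaves work backwards along the computation: here the accepting
  -- paths from c split according to the first step.
  behaves-node : ∀ {b c} {I : Set} {A : I → Set} →
    state c ≢ accept → Fits b (work c) →
    (choices : I ↔ (Σ[ a ∈ _ ] T (allowed c a))) →
    (∀ i → Behaves b (perform (proj₁ (to choices i)) c) (A i)) →
    Behaves b c (Σ I A)
  behaves-node {b} {c} {I} {A} rejecting c-fits choices after = record
    { halts  = acc λ { (step a ok) → halts (branch (a , ok)) }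
    ; fits   = λ { _ ε → c-fits ; _ (step a ok ◅ path) → fits (branch (a , ok)) _ path }
    ; counts = ↔-sym (Σ-↔ choices (λ {i} → ↔-sym (counts (after i)))) ↔-∘ firstStep
    }
    where
    branch : (s : Σ[ a ∈ _ ] T (allowed c a)) →
             Behaves b (perform (proj₁ s) c) (A (from choices s))
    branch s = subst (λ s′ → Behaves b (perform (proj₁ s′) c) (A (from choices s)))
                     (strictlyInverseˡ choices s) (after (from choices s))

    firstStep : AcceptingFrom c ↔
                (Σ[ s ∈ (Σ[ a ∈ _ ] T (allowed c a)) ] AcceptingFrom (perform (proj₁ s) c))
    firstStep = mk↔ₛ′
      (λ { (_ , ε , e) → contradiction e rejecting
         ; (c′ , step a ok ◅ path , e) → (a , ok) , c′ , path , e })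
      (λ { ((a , ok) , c′ , path , e) → c′ , step a ok ◅ path , e })
      (λ _ → refl)
      (λ { (_ , ε , e) → contradiction e rejecting ; (_ , step _ _ ◅ _ , _) → refl })

  behaves-↔ : ∀ {b c} {A B : Set} → A ↔ B → Behaves b c A → Behaves b c B
  behaves-↔ A↔B c-behaves = record
    { halts  = halts c-behaves
    ; fits   = fits c-behaves
    ; counts = A↔B ↔-∘ counts c-behaves
    }

  behaves-step : ∀ {b c} {A : Set} → state c ≢ accept → Fits b (work c) →
    ∀ a₀ → T (allowed c a₀) → (∀ a → T (allowed c a) → a ≡ a₀) →
    Behaves b (perform a₀ c) A → Behaves b c A
  behaves-step {c = c} rejecting c-fits a₀ ok unique next-behaves =
    behaves-↔ (mk↔ₛ′ proj₂ (tt ,_) (λ _ → refl) (λ _ → refl))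
      (behaves-node rejecting c-fits only (λ _ → next-behaves))
    where
    only : ⊤ ↔ (Σ[ a ∈ _ ] T (allowed c a))
    only = mk↔ₛ′ (λ _ → a₀ , ok) (λ _ → tt) (λ (a , ok′) → same a ok′ (unique a ok′)) (λ _ → refl)
      where
      same : ∀ a ok′ → a ≡ a₀ → (a₀ , ok) ≡ (a , ok′)
      same a ok′ refl = cong (a₀ ,_) (T-irrelevant ok ok′)

  behaves-stuck : ∀ {b c} → state c ≢ accept → Fits b (work c) →
    (∀ a → ¬ T (allowed c a)) → Behaves b c ⊥
  behaves-stuck {c = c} rejecting c-fits stuck =
    behaves-↔ (mk↔ₛ′ proj₁ (λ ()) (λ ()) (λ ()))
      (behaves-node {A = λ _ → ⊥} rejecting c-fits none (λ ()))
    where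
    none : ⊥ ↔ (Σ[ a ∈ _ ] T (allowed c a))
    none = mk↔ₛ′ (λ ()) (λ (a , ok) → stuck a ok) (λ (a , ok) → contradiction ok (stuck a)) (λ ())

-- Real-time counter automata

-- The operations on a counter.  Decrementing zero and testing a nonzero counter
-- for zero are impossible and end the run without acceptance.
data Op : Set where
  inc dec isZero : Op

natStep : Op → ℕ → Maybe ℕ
natStep inc    n       = just (suc n)
natStep dec    zero    = nothing
natStep dec    (suc n) = just n
natStep isZero zero    = just zero
natStep isZero (suc n) = nothing

-- After op vs P is P at the counters that result from op, and empty if op is
-- impossible.  The value nothing is the operation that does nothing.
After : ∀ {K} → Maybe (Op × Fin K) → Vec ℕ K → (Vec ℕ K → Set) → Set
After nothing        vs P = P vs
After (just (o , t)) vs P = maybe′ (λ v → P (vs [ t ]≔ v)) ⊥ (natStep o (lookup vs t))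

isZero-↔ : ∀ {k} t (vs : Vec ℕ k) P →
  After (just (isZero , t)) vs P ↔ (lookup vs t ≡ 0 × P (vs [ t ]≔ 0))
isZero-↔ t vs P with lookup vs t
... | zero  = mk↔ₛ′ (refl ,_) proj₂ (λ (e , y) → cong (_, y) (uip refl e)) (λ _ → refl)
... | suc _ = both-empty id (λ ())

-- A real-time nondeterministic counter automaton.  On reading a symbol b in state
-- q, it moves to some q′ with goes q b q′ and performs the operation entry
-- (just q′) belonging to the state entered.  At the end of the input it may stop
-- in q if ends q holds, provided that the operation entry nothing is possible.
-- There are K counters, all zero at first.
record CounterAutomaton : Set₁ where
  field
    Q       : Set
    finiteQ : Finite Q
    K       : ℕ
    start   : Q
    goes    : Q → Bool → Q → Bool
    ends    : Q → Bool
    entry   : Maybe Q → Maybe (Op × Fin K)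

  -- The accepting runs on a word from a given state with given counters.
  Run : Q → Vec ℕ K → Word → Set
  Run q vs []      = T (ends q) × After (entry nothing) vs (λ _ → ⊤)
  Run q vs (b ∷ w) = Σ[ q′ ∈ Q ] T (goes q b q′) × After (entry (just q′)) vs (λ vs′ → Run q′ vs′ w)

  finite-After : ∀ m vs {P : Vec ℕ K → Set} → (∀ vs → Finite (P vs)) → Finite (After m vs P)
  finite-After nothing        vs P-fin = P-fin vs
  finite-After (just (o , t)) vs P-fin with natStep o (lookup vs t)
  ... | nothing = finite-⊥
  ... | just v  = P-fin (vs [ t ]≔ v)

  finite-Run : ∀ q vs w → Finite (Run q vs w)
  finite-Run q vs []      = finite-Σ (finite-T _) (λ _ → finite-After (entry nothing) vs (λ _ → finite-⊤))
  finite-Run q vs (b ∷ w) = finite-Σ finiteQ (λ q′ → finite-Σ (finite-T _) (λ _ →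
    finite-After (entry (just q′)) vs (λ vs′ → finite-Run q′ vs′ w)))

-- Binary numerals

-- Numerals list the least significant digit first and may end in zeros.
value : List Bool → ℕ
value []           = 0
value (false ∷ bs) = 2 * value bs
value (true  ∷ bs) = suc (2 * value bs)

-- The operations on numerals.  A numeral never gets shorter: the zeros that a
-- decrement leaves at its end stay.
bitStep : Op → List Bool → Maybe (List Bool)
bitStep inc    []           = just (true ∷ [])
bitStep inc    (false ∷ bs) = just (true ∷ bs)
bitStep inc    (true  ∷ bs) = Maybe.map (false ∷_) (bitStep inc bs)
bitStep dec    []           = nothing
bitStep dec    (false ∷ bs) = Maybe.map (true ∷_) (bitStep dec bs)
bitStep dec    (true  ∷ bs) = just (false ∷ bs)
bitStep isZero []           = just []
bitStep isZero (false ∷ bs) = Maybe.map (false ∷_) (bitStep isZero bs)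
bitStep isZero (true  ∷ bs) = nothing

bitStep-value : ∀ o bs → Maybe.map value (bitStep o bs) ≡ natStep o (value bs)
bitStep-value inc    []           = refl
bitStep-value inc    (false ∷ bs) = refl
bitStep-value inc    (true  ∷ bs) with bitStep inc bs | bitStep-value inc bs
... | just bs′ | eq = cong just (trans (cong (2 *_) (Maybe.just-injective eq)) (*-suc 2 (value bs)))
bitStep-value dec    []           = refl
bitStep-value dec    (false ∷ bs) with value bs | bitStep dec bs | bitStep-value dec bs
... | zero  | nothing  | eq = refl
... | suc v | just bs′ | eq = cong just (trans (cong (λ n → suc (2 * n)) (Maybe.just-injective eq)) (sym (+-suc v (v + 0))))
bitStep-value dec    (true  ∷ bs) = refl
bitStep-value isZero []           = refl
bitStep-value isZero (false ∷ bs) with value bs | bitStep isZero bs | bitStep-value isZero bs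
... | zero  | just bs′ | eq = cong just (cong (2 *_) (Maybe.just-injective eq))
... | suc v | nothing  | eq = refl
bitStep-value isZero (true  ∷ bs) = refl

-- A numeral grows only when a carry creates a new leading digit, and then its
-- length is logarithmic in its value.  Superfluous zeros prevent such a bound
-- at other times, so the length has to be bounded by the values it had before.
bitStep-length : ∀ o bs {bs′} → bitStep o bs ≡ just bs′ →
  length bs′ ≤ length bs ⊎ 2 ^ length bs′ ≤ 2 * value bs′
bitStep-length inc    []           refl = inj₂ ≤-refl
bitStep-length inc    (false ∷ bs) refl = inj₁ ≤-refl
bitStep-length inc    (true  ∷ bs) eq with bitStep inc bs | bitStep-length inc bs
bitStep-length inc    (true  ∷ bs) refl | just bs″ | ih with ih refl
... | inj₁ le = inj₁ (s≤s le)
... | inj₂ p  = inj₂ (*-monoʳ-≤ 2 p)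
bitStep-length dec    (false ∷ bs) eq with bitStep dec bs | bitStep-length dec bs
bitStep-length dec    (false ∷ bs) refl | just bs″ | ih with ih refl
... | inj₁ le = inj₁ (s≤s le)
... | inj₂ p  = inj₂ (*-monoʳ-≤ 2 (m≤n⇒m≤1+n p))
bitStep-length dec    (true  ∷ bs) refl = inj₁ ≤-refl
bitStep-length isZero []           refl = inj₁ ≤-refl
bitStep-length isZero (false ∷ bs) eq with bitStep isZero bs | bitStep-length isZero bs
bitStep-length isZero (false ∷ bs) refl | just bs″ | ih with ih refl
... | inj₁ le = inj₁ (s≤s le)
... | inj₂ p  = inj₂ (*-monoʳ-≤ 2 p)

natStep-≤ : ∀ o {n n′} → natStep o n ≡ just n′ → n′ ≤ suc n
natStep-≤ inc    refl = ≤-refl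
natStep-≤ dec {suc n}  refl = m≤n⇒m≤1+n (n≤1+n n)
natStep-≤ isZero {zero} refl = z≤n

-- Phases and single digits in the simulation

-- The simulating machine cycles through these phases: in ready it reads an input
-- symbol, in enter it looks up the operation of the state entered, in operate the
-- head of one work tape moves right over the numeral while modifying it, and in
-- back this head returns to its home cell.
data Phase : Set where
  ready enter operate back : Phase

finite-Phase : Finite Phase
finite-Phase = 4 , mk↔ₛ′
  (λ { ready → 0F ; enter → 1F ; operate → 2F ; back → 3F })
  (λ { 0F → ready ; 1F → enter ; 2F → operate ; 3F → back })
  (λ { 0F → refl ; 1F → refl ; 2F → refl ; 3F → refl })
  (λ { ready → refl ; enter → refl ; operate → refl ; back → refl })

-- What the head does on a digit or blank in phase operate: overwrite it and go on
-- to the right, overwrite it and turn back, or halt.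
data Reaction : Set where
  carry  : Bool → Reaction
  settle : Maybe Bool → Reaction
  jam    : Reaction

-- One digit of bitStep.  The blank after the numeral acts as a zero for inc, signals
-- underflow for dec and success for isZero.
react : Op → Maybe Bool → Reaction
react inc    nothing      = settle (just true)
react inc    (just false) = settle (just true)
react inc    (just true)  = carry false
react dec    nothing      = jam
react dec    (just false) = carry true
react dec    (just true)  = settle (just false)
react isZero nothing      = settle nothing
react isZero (just false) = carry false
react isZero (just true)  = jam

-- Work tapes holding numerals

lookup-[]≔ : ∀ {n} {X : Set} (xs : Vec X n) t {x} → lookup (xs [ t ]≔ x) t ≡ x
lookup-[]≔ xs t = Vec.lookup∘updateAt t xs

-- A zero test leaves an explicitly visited blank cell after the numeral; whether
-- there is one is recorded by a Boolean.
pad : Bool → List (Maybe Bool)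
pad false = []
pad true  = nothing ∷ []

digits : List Bool → Bool → List (Maybe Bool)
digits bs e = List.map just bs ++ pad e

-- The tape in phase ready: the head is on a blank cell that is never written and
-- marks the left end, with the numeral to its right.
home : List Bool → Bool → Tape (Maybe Bool)
home bs e = tape [] nothing (digits bs e)

-- The cells left of the head, from the head outwards, after it has passed the
-- digits ds, the last one first, on its way from the blank home cell.
passed : List Bool → List (Maybe Bool)
passed ds = List.map just ds ++ nothing ∷ []

-- The tape when the head has just moved right from the cells ls onto the first of
-- the remaining digits bs, or onto the blank after them.
arriving : List (Maybe Bool) → List Bool → Bool → Tape (Maybe Bool)
arriving ls []       e = tape ls nothing []
arriving ls (b ∷ bs) e = tape ls (just b) (digits bs e)

-- The tape when the head has just moved left from the cells rs onto the last of
-- the digits ds, or onto the home cell.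
returning : List Bool → List (Maybe Bool) → Tape (Maybe Bool)
returning []       rs = tape [] nothing rs
returning (d ∷ ds) rs = tape (passed ds) (just d) rs

right-arriving : ∀ ls h bs e →
  moveWork nothing right (tape ls h (digits bs e)) ≡ arriving (h ∷ ls) bs e
right-arriving ls h []       false = refl
right-arriving ls h []       true  = refl
right-arriving ls h (b ∷ bs) e     = refl

left-returning : ∀ ds h rs →
  moveWork nothing left (tape (passed ds) h rs) ≡ returning ds (h ∷ rs)
left-returning []       h rs = refl
left-returning (d ∷ ds) h rs = refl

cells-digits : ∀ bs e → length (digits bs e) ≤ suc (length bs)
cells-digits bs e = begin
  length (digits bs e)                        ≡⟨ List.length-++ (List.map just bs) ⟩
  length (List.map just bs) + length (pad e)  ≡⟨ cong (_+ length (pad e)) (List.length-map just bs) ⟩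
  length bs + length (pad e)                  ≤⟨ +-monoʳ-≤ (length bs) (pad≤1 e) ⟩
  length bs + 1                               ≡⟨ +-comm (length bs) 1 ⟩
  suc (length bs)                             ∎
  where
  open ≤-Reasoning
  pad≤1 : ∀ e → length (pad e) ≤ 1
  pad≤1 false = z≤n
  pad≤1 true  = s≤s z≤n

cells-home : ∀ bs e → cells (home bs e) ≤ length bs + 2
cells-home bs e = ≤-trans (s≤s (cells-digits bs e)) (≤-reflexive (+-comm 2 (length bs)))

cells-arriving : ∀ ds bs e → cells (arriving (passed ds) bs e) ≤ length ds + length bs + 2
cells-arriving ds bs e rewrite +-assoc (length ds) (length bs) 2 = lemma bs
  where
  open ≤-Reasoning
  len-passed : length (passed ds) ≡ length ds + 1
  len-passed = trans (List.length-++ (List.map just ds)) (cong (_+ 1) (List.length-map just ds))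
  lemma : ∀ bs → cells (arriving (passed ds) bs e) ≤ length ds + (length bs + 2)
  lemma [] rewrite len-passed | +-identityʳ (length ds + 1 + 1) = ≤-reflexive (+-assoc (length ds) 1 1)
  lemma (b ∷ bs) rewrite len-passed = begin
    length ds + 1 + 1 + length (digits bs e)  ≡⟨ cong (_+ length (digits bs e)) (+-assoc (length ds) 1 1) ⟩
    length ds + 2 + length (digits bs e)      ≤⟨ +-monoʳ-≤ (length ds + 2) (cells-digits bs e) ⟩
    length ds + 2 + suc (length bs)           ≡⟨ +-assoc (length ds) 2 (suc (length bs)) ⟩
    length ds + (2 + suc (length bs))         ≡⟨ cong (length ds +_) (+-comm 2 (suc (length bs))) ⟩
    length ds + (suc (length bs) + 2)         ∎

cells-left : ∀ ds h rs → cells (returning ds (h ∷ rs)) ≡ cells (tape (passed ds) h rs)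
cells-left []       h rs = refl
cells-left (d ∷ ds) h rs = +-suc (length (passed ds) + 1) (length rs)

-- The input tape with the part w still to be read and the head on its first symbol.
reading : List InputSymbol → Word → Tape InputSymbol
reading ls []      = tape ls rightEnd []
reading ls (b ∷ w) = tape ls (bit b) (List.map bit w ++ rightEnd ∷ [])

right-reading : ∀ ls h w →
  moveInput right (tape ls h (List.map bit w ++ rightEnd ∷ [])) ≡ reading (h ∷ ls) w
right-reading ls h []      = refl
right-reading ls h (_ ∷ _) = refl

-- Simulation of counter automata by Turing machines

module Compile (A : CounterAutomaton) where
  open CounterAutomaton A

  -- The control state nothing stands for having read the whole input.  Work tapes
  -- have the alphabet of blank, 0 and 1.
  State Γ : Set
  State = Phase × Maybe Q
  Γ     = Maybe Bool

  Act : Set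
  Act = Action State Γ K

  -- The action that leaves all work tapes alone, and the action on a single one.
  idle : State → Direction → Vec Γ K → Act
  idle s d γs = action s d γs (replicate K stay)

  touch : State → Vec Γ K → Fin K → Γ → Direction → Act
  touch s γs t g d = action s stay (γs [ t ]≔ g) (replicate K stay [ t ]≔ d)

  respond : Maybe Q → Vec Γ K → Fin K → Reaction → Maybe Act
  respond q γs t (carry b)  = just (touch (operate , q) γs t (just b) right)
  respond q γs t (settle g) = just (touch (back , q) γs t g left)
  respond q γs t jam        = nothing

  rewind : Maybe Q → Vec Γ K → Fin K → Γ → Maybe Act
  rewind q γs t (just b) = just (touch (back , q) γs t (just b) left)
  rewind q γs t nothing  = just (idle (ready , q) stay γs)

  -- The deterministic phases; the third argument is the operation of the state.
  perPhase : Phase → Maybe Q → Maybe (Op × Fin K) → Vec Γ K → Maybe Act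
  perPhase ready   q _              γs = nothing
  perPhase enter   q nothing        γs = just (idle (ready , q) stay γs)
  perPhase enter   q (just (o , t)) γs = just (touch (operate , q) γs t (lookup γs t) right)
  perPhase operate q nothing        γs = nothing
  perPhase operate q (just (o , t)) γs = respond q γs t (react o (lookup γs t))
  perPhase back    q nothing        γs = nothing
  perPhase back    q (just (o , t)) γs = rewind q γs t (lookup γs t)

  -- The only action that may lead to the next state given as last argument, which
  -- matters only when an input bit is read, the one nondeterministic step.
  next : State → InputSymbol → Vec Γ K → State → Maybe Act
  next (ready , just q) leftEnd  γs _ = just (idle (ready , just q) right γs)
  next (ready , just q) rightEnd γs _ =
    if ends q then just (idle (enter , nothing) stay γs) else nothing
  next (ready , just q) (bit b)  γs (enter , just q′) =
    if goes q b q′ then just (idle (enter , just q′) right γs) else nothing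
  next (ready , just q) (bit b)  γs _ = nothing
  next (p , q)          σ        γs _ = perPhase p q (entry q) γs

  finite-State : Finite State
  finite-State = finite-Σ finite-Phase (λ _ → finite-Maybe finiteQ)

  finite-Γ : Finite Γ
  finite-Γ = finite-Maybe finite-Bool

  finite-Direction : Finite Direction
  finite-Direction = 3 , mk↔ₛ′
    (λ { left → 0F ; stay → 1F ; right → 2F })
    (λ { 0F → left ; 1F → stay ; 2F → right })
    (λ { 0F → refl ; 1F → refl ; 2F → refl })
    (λ { left → refl ; stay → refl ; right → refl })

  _≟ₐ_ : DecidableEquality Act
  _≟ₐ_ = via-injection (mk↣ {to = parts} λ { refl → refl })
    (Product.≡-dec (finite-≟ finite-State)
      (Product.≡-dec (finite-≟ finite-Direction)
        (Product.≡-dec (Vec.≡-dec (finite-≟ finite-Γ)) (Vec.≡-dec (finite-≟ finite-Direction)))))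
    where
    parts : Act → State × Direction × Vec Γ K × Vec Direction K
    parts (action s d γs ds) = s , d , γs , ds

  machine : NTM
  machine = record
    { State       = State
    ; stateCount  = proj₁ finite-State
    ; finiteState = proj₂ finite-State
    ; Γ           = Γ
    ; symbolCount = proj₁ finite-Γ
    ; finiteΓ     = proj₂ finite-Γ
    ; blank       = nothing
    ; tapes       = K
    ; start       = ready , just start
    ; accept      = ready , nothing
    ; δ           = λ s σ γs a → ⌊ Maybe.≡-dec _≟ₐ_ (next s σ γs (Action.nextState a)) (just a) ⌋
    ; acceptHalts = λ _ _ _ ()
    }

  open Computation machine
  open Trees machine

  allowed⇒next : ∀ c a → T (allowed c a) →
    next (state c) (head (input c)) (Vec.map head (work c)) (Action.nextState a) ≡ just a
  allowed⇒next c a = toWitness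

  next⇒allowed : ∀ c a →
    next (state c) (head (input c)) (Vec.map head (work c)) (Action.nextState a) ≡ just a →
    T (allowed c a)
  next⇒allowed c a = fromWitness

  -- Rewriting the scanned symbols without moving changes nothing.
  stay-put : ∀ {k} (ws : Vec (Tape Γ) k) →
    Vec.zipWith (moveWork nothing) (replicate k stay) (Vec.zipWith write (Vec.map head ws) ws) ≡ ws
  stay-put []       = refl
  stay-put (w ∷ ws) = cong (w ∷_) (stay-put ws)

  move-one : ∀ {k} (ws : Vec (Tape Γ) k) t g d →
    Vec.zipWith (moveWork nothing) (replicate k stay [ t ]≔ d)
      (Vec.zipWith write (Vec.map head ws [ t ]≔ g) ws)
    ≡ ws [ t ]≔ moveWork nothing d (write g (lookup ws t))
  move-one (w ∷ ws) zero    g d = cong (_ ∷_) (stay-put ws)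
  move-one (w ∷ ws) (suc t) g d = cong (w ∷_) (move-one ws t g d)

  behaves-next : ∀ {b c R} → state c ≢ (ready , nothing) → Fits b (work c) →
    ∀ a₀ → (∀ s → next (state c) (head (input c)) (Vec.map head (work c)) s ≡ just a₀) →
    Behaves b (perform a₀ c) R → Behaves b c R
  behaves-next {c = c} rejecting c-fits a₀ eq =
    behaves-step rejecting c-fits a₀ (next⇒allowed c a₀ (eq _))
      (λ a ok → Maybe.just-injective (trans (sym (allowed⇒next c a ok)) (eq _)))

  behaves-idle : ∀ {b s s′ i ws R} d → s ≢ (ready , nothing) → Fits b ws →
    (∀ s″ → next s (head i) (Vec.map head ws) s″ ≡ just (idle s′ d (Vec.map head ws))) →
    Behaves b (config s′ (moveInput d i) ws) R → Behaves b (config s i ws) R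
  behaves-idle {b} {s′ = s′} {i} {ws} {R} d rejecting ws-fits eq =
    behaves-next rejecting ws-fits _ eq
    ∘ subst (λ ws′ → Behaves b (config s′ (moveInput d i) ws′) R) (sym (stay-put ws))

  fits-[]≔ : ∀ {b} ws t {T} → Fits b ws → cells T ≤ b → Fits b (ws [ t ]≔ T)
  fits-[]≔ ws t ws-fits T-fits t′ with t′ Fin.≟ t
  ... | yes refl = subst (λ T → cells T ≤ _) (sym (lookup-[]≔ ws t)) T-fits
  ... | no t′≢t  = subst (λ T → cells T ≤ _) (sym (Vec.lookup∘updateAt′ t′ t t′≢t ws)) (ws-fits t′)

  behaves-touch : ∀ {b s s′ i R} ws t T g d → s ≢ (ready , nothing) → Fits b (ws [ t ]≔ T) →
    (∀ s″ → next s (head i) (Vec.map head (ws [ t ]≔ T)) s″ ≡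
            just (touch s′ (Vec.map head (ws [ t ]≔ T)) t g d)) →
    Behaves b (config s′ i (ws [ t ]≔ moveWork nothing d (write g T))) R →
    Behaves b (config s i (ws [ t ]≔ T)) R
  behaves-touch {b} {s′ = s′} {i} {R} ws t T g d rejecting ws-fits eq =
    behaves-next rejecting ws-fits _ eq
    ∘ subst (λ ws′ → Behaves b (config s′ i ws′) R) (sym ws-moves)
    where
    open ≡-Reasoning
    ws-moves : Vec.zipWith (moveWork nothing) (replicate K stay [ t ]≔ d)
                 (Vec.zipWith write (Vec.map head (ws [ t ]≔ T) [ t ]≔ g) (ws [ t ]≔ T))
               ≡ ws [ t ]≔ moveWork nothing d (write g T)
    ws-moves = begin
      _ ≡⟨ move-one (ws [ t ]≔ T) t g d ⟩
      (ws [ t ]≔ T) [ t ]≔ moveWork nothing d (write g (lookup (ws [ t ]≔ T) t))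
        ≡⟨ Vec.[]≔-idempotent ws t ⟩
      ws [ t ]≔ moveWork nothing d (write g (lookup (ws [ t ]≔ T) t))
        ≡⟨ cong (λ T → ws [ t ]≔ moveWork nothing d (write g T)) (lookup-[]≔ ws t) ⟩
      ws [ t ]≔ moveWork nothing d (write g T) ∎

  -- The operation o of the state q on the work tape t; the vector ws provides the
  -- other work tapes.
  module Operation {b q o t} (entry-q : entry q ≡ just (o , t)) (i : Tape InputSymbol)
                   (ws : Vec (Tape Γ) K) (ws-fits : Fits b ws) where

    -- The configuration in phase p with T as the work tape t.
    At : Phase → Tape Γ → Config
    At p T = config (p , q) i (ws [ t ]≔ T)

    scanned : ∀ T → lookup (Vec.map head (ws [ t ]≔ T)) t ≡ head T
    scanned T = trans (Vec.lookup-map t head (ws [ t ]≔ T)) (cong head (lookup-[]≔ ws t))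

    behaves-rewind : ∀ {R} ds bs e → cells (returning ds (digits bs e)) ≤ b →
      Behaves b (At ready (home (ds ʳ++ bs) e)) R →
      Behaves b (At back (returning ds (digits bs e))) R
    behaves-rewind [] bs e T-fits =
      behaves-idle stay (λ ()) (fits-[]≔ ws t ws-fits T-fits) eq
      where
      eq : ∀ s → next (back , q) (head i) (Vec.map head (ws [ t ]≔ home bs e)) s ≡
                 just (idle (ready , q) stay (Vec.map head (ws [ t ]≔ home bs e)))
      eq s rewrite entry-q | scanned (home bs e) = refl
    behaves-rewind {R} (d ∷ ds) bs e T-fits after =
      behaves-touch ws t T₀ (just d) left (λ ()) (fits-[]≔ ws t ws-fits T-fits) eq
        (subst (λ T → Behaves b (At back T) R) (sym (left-returning ds (just d) (digits bs e)))
          (behaves-rewind ds (d ∷ bs) e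
            (≤-trans (≤-reflexive (cells-left ds (just d) (digits bs e))) T-fits) after))
      where
      T₀ = returning (d ∷ ds) (digits bs e)
      eq : ∀ s → next (back , q) (head i) (Vec.map head (ws [ t ]≔ T₀)) s ≡
                 just (touch (back , q) (Vec.map head (ws [ t ]≔ T₀)) t (just d) left)
      eq s rewrite entry-q | scanned T₀ = refl

    next-operate : ∀ T s → next (operate , q) (head i) (Vec.map head (ws [ t ]≔ T)) s ≡
                        respond q (Vec.map head (ws [ t ]≔ T)) t (react o (head T))
    next-operate T s rewrite entry-q | scanned T = refl

    shift-≤ : ∀ (ds bs : List Bool) → length ds + suc (length bs) + 2 ≤ b →
              suc (length ds) + length bs + 2 ≤ b
    shift-≤ ds bs = subst (λ n → n + 2 ≤ b) (+-suc (length ds) (length bs))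

    -- The digits ds, the last one first, have been passed and rewritten already, so
    -- the resulting numeral is ds reversed followed by the result on the other digits.
    behaves-carry : ∀ (R : List Bool → Set) ds c d bs e r → react o (just c) ≡ carry d →
      length ds + suc (length bs) + 2 ≤ b →
      Behaves b (At operate (arriving (passed (d ∷ ds)) bs e)) (maybe′ (R ∘ (d ∷_)) ⊥ r) →
      Behaves b (At operate (arriving (passed ds) (c ∷ bs) e)) (maybe′ R ⊥ (Maybe.map (d ∷_) r))
    behaves-carry R ds c d bs e r reacts bs-fits after =
      behaves-touch ws t T₀ (just d) right (λ ())
        (fits-[]≔ ws t ws-fits (≤-trans (cells-arriving ds (c ∷ bs) e) bs-fits))
        (λ s → trans (next-operate T₀ s) (cong (respond q _ t) reacts))
        (subst₂ (λ T R → Behaves b (At operate T) R)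
          (sym (right-arriving (passed ds) (just d) bs e)) (sym (Maybe.maybe′-map R ⊥ (d ∷_) r)) after)
      where T₀ = arriving (passed ds) (c ∷ bs) e

    behaves-settle : ∀ {R} ds h rs g bs e → react o h ≡ settle g → g ∷ rs ≡ digits bs e →
      cells (tape (passed ds) h rs) ≤ b →
      Behaves b (At ready (home (ds ʳ++ bs) e)) R →
      Behaves b (At operate (tape (passed ds) h rs)) R
    behaves-settle {R} ds h rs g bs e reacts settled T-fits after =
      behaves-touch ws t T₀ g left (λ ()) (fits-[]≔ ws t ws-fits T-fits)
        (λ s → trans (next-operate T₀ s) (cong (respond q _ t) reacts))
        (subst (λ T → Behaves b (At back T) R)
          (trans (cong (returning ds) (sym settled)) (sym (left-returning ds g rs)))
          (behaves-rewind ds bs e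
            (≤-trans (≤-reflexive (trans (cong (cells ∘ returning ds) (sym settled)) (cells-left ds g rs))) T-fits)
            after))
      where T₀ = tape (passed ds) h rs

    behaves-jam : ∀ ds h rs → react o h ≡ jam → cells (tape (passed ds) h rs) ≤ b →
      Behaves b (At operate (tape (passed ds) h rs)) ⊥
    behaves-jam ds h rs reacts T-fits =
      behaves-stuck (λ ()) (fits-[]≔ ws t ws-fits T-fits) λ a ok →
        contradiction (trans (sym (trans (next-operate T₀ (Action.nextState a)) (cong (respond q _ t) reacts)))
                             (allowed⇒next (At operate T₀) a ok)) λ ()
      where T₀ = tape (passed ds) h rs

    -- The operation as a whole.  The operation o′ agrees with o; it is a separate
    -- argument so that it can be analysed by cases while o is fixed by q.
    behaves-operate : ∀ o′ → (∀ h → react o h ≡ react o′ h) → ∀ (R : List Bool → Set) ds bs e →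
      length ds + length bs + 2 ≤ b →
      (∀ bs′ e′ → bitStep o′ bs ≡ just bs′ → Behaves b (At ready (home (ds ʳ++ bs′) e′)) (R bs′)) →
      Behaves b (At operate (arriving (passed ds) bs e)) (maybe′ R ⊥ (bitStep o′ bs))
    behaves-operate inc reacts R ds [] e bs-fits after =
      behaves-settle ds nothing [] (just true) (true ∷ []) false (reacts _) refl
        (≤-trans (cells-arriving ds [] e) bs-fits) (after _ _ refl)
    behaves-operate inc reacts R ds (false ∷ bs) e bs-fits after =
      behaves-settle ds (just false) (digits bs e) (just true) (true ∷ bs) e (reacts _) refl
        (≤-trans (cells-arriving ds (false ∷ bs) e) bs-fits) (after _ _ refl)
    behaves-operate inc reacts R ds (true ∷ bs) e bs-fits after =
      behaves-carry R ds true false bs e (bitStep inc bs) (reacts _) bs-fits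
        (behaves-operate inc reacts _ (false ∷ ds) bs e (shift-≤ ds bs bs-fits)
          (λ bs′ e′ eq → after _ e′ (cong (Maybe.map (false ∷_)) eq)))
    behaves-operate dec reacts R ds [] e bs-fits after =
      behaves-jam ds nothing [] (reacts _) (≤-trans (cells-arriving ds [] e) bs-fits)
    behaves-operate dec reacts R ds (false ∷ bs) e bs-fits after =
      behaves-carry R ds false true bs e (bitStep dec bs) (reacts _) bs-fits
        (behaves-operate dec reacts _ (true ∷ ds) bs e (shift-≤ ds bs bs-fits)
          (λ bs′ e′ eq → after _ e′ (cong (Maybe.map (true ∷_)) eq)))
    behaves-operate dec reacts R ds (true ∷ bs) e bs-fits after =
      behaves-settle ds (just true) (digits bs e) (just false) (false ∷ bs) e (reacts _) refl
        (≤-trans (cells-arriving ds (true ∷ bs) e) bs-fits) (after _ _ refl)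
    behaves-operate isZero reacts R ds [] e bs-fits after =
      behaves-settle ds nothing [] nothing [] true (reacts _) refl
        (≤-trans (cells-arriving ds [] e) bs-fits) (after _ _ refl)
    behaves-operate isZero reacts R ds (false ∷ bs) e bs-fits after =
      behaves-carry R ds false false bs e (bitStep isZero bs) (reacts _) bs-fits
        (behaves-operate isZero reacts _ (false ∷ ds) bs e (shift-≤ ds bs bs-fits)
          (λ bs′ e′ eq → after _ e′ (cong (Maybe.map (false ∷_)) eq)))
    behaves-operate isZero reacts R ds (true ∷ bs) e bs-fits after =
      behaves-jam ds (just true) (digits bs e) (reacts _)
        (≤-trans (cells-arriving ds (true ∷ bs) e) bs-fits)

  -- The work tape w is at home with a numeral for v.  The number X bounds all
  -- counter values that occur, and r bounds the number of increments to come.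
  record Counter (X r : ℕ) (w : Tape Γ) (v : ℕ) : Set where
    constructor counter
    field
      bits    : List Bool
      padded  : Bool
      tape≡   : w ≡ home bits padded
      value≡  : value bits ≡ v
      value≤  : v + r ≤ X
      length≤ : 2 ^ length bits ≤ 2 * X

  Counters : ℕ → ℕ → Vec (Tape Γ) K → Vec ℕ K → Set
  Counters X r ws vs = ∀ t → Counter X r (lookup ws t) (lookup vs t)

  -- The number b is a bound on the tape length that suffices for counters up to X.
  module Simulation {X b : ℕ} (roomy : ∀ l → 2 ^ l ≤ 2 * X → l + 2 ≤ b) where

    counters-fit : ∀ {r} ws vs → Counters X r ws vs → Fits b ws
    counters-fit ws vs cs t with cs t
    ... | counter bs e tape≡ _ _ length≤ rewrite tape≡ = ≤-trans (cells-home bs e) (roomy _ length≤)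

    relax : ∀ {r w v} → Counter X (suc r) w v → Counter X r w v
    relax {r} {v = v} (counter bs e tape≡ value≡ value≤ length≤) =
      counter bs e tape≡ value≡ (≤-trans (+-monoʳ-≤ v (n≤1+n r)) value≤) length≤

    counter-step : ∀ o {r v v′} bs {bs′} e′ → value bs ≡ v → v + suc r ≤ X → 2 ^ length bs ≤ 2 * X →
      bitStep o bs ≡ just bs′ → natStep o v ≡ just v′ → Counter X r (home bs′ e′) v′
    counter-step o {r} {v} {v′} bs {bs′} e′ refl value≤ length≤ bs-steps v-steps =
      counter bs′ e′ refl value≡ value′≤ length′≤
      where
      open ≤-Reasoning
      value≡ : value bs′ ≡ v′
      value≡ = Maybe.just-injective
        (trans (trans (sym (cong (Maybe.map value) bs-steps)) (bitStep-value o bs)) v-steps)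
      value′≤ : v′ + r ≤ X
      value′≤ = begin
        v′ + r     ≤⟨ +-monoˡ-≤ r (natStep-≤ o v-steps) ⟩
        suc v + r  ≡⟨ +-suc v r ⟨
        v + suc r  ≤⟨ value≤ ⟩
        X          ∎
      length′≤ : 2 ^ length bs′ ≤ 2 * X
      length′≤ with bitStep-length o bs bs-steps
      ... | inj₁ shorter = ≤-trans (^-monoʳ-≤ 2 shorter) length≤
      ... | inj₂ grown   = ≤-trans grown (*-monoʳ-≤ 2
        (≤-trans (≤-reflexive value≡) (≤-trans (m≤m+n v′ r) value′≤)))

    counters-[]≔ : ∀ {r} ws vs t {w v} → Counters X (suc r) ws vs → Counter X r w v →
                   Counters X r (ws [ t ]≔ w) (vs [ t ]≔ v)
    counters-[]≔ {r} ws vs t cs c t′ with t′ Fin.≟ t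
    ... | yes refl = subst₂ (Counter X r) (sym (lookup-[]≔ ws t)) (sym (lookup-[]≔ vs t)) c
    ... | no t′≢t  = subst₂ (Counter X r) (sym (Vec.lookup∘updateAt′ t′ t t′≢t ws))
                       (sym (Vec.lookup∘updateAt′ t′ t t′≢t vs)) (relax (cs t′))

    -- Performing the operation of q consumes one of the suc r increments allowed.
    behaves-enter : ∀ q i ws vs r (P : Vec ℕ K → Set) → Counters X (suc r) ws vs →
      (∀ ws′ vs′ → Counters X r ws′ vs′ → Behaves b (config (ready , q) i ws′) (P vs′)) →
      Behaves b (config (enter , q) i ws) (After (entry q) vs P)
    behaves-enter q i ws vs r P cs after with entry q in entry-q
    ... | nothing = behaves-idle stay (λ ()) (counters-fit ws vs cs) eq (after ws vs (relax ∘ cs))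
      where
      eq : ∀ s → next (enter , q) (head i) (Vec.map head ws) s ≡
                 just (idle (ready , q) stay (Vec.map head ws))
      eq s rewrite entry-q = refl
    ... | just (o , t) with cs t
    ... | counter bs e tape≡ value≡ value≤ length≤ =
      subst (λ ws → Behaves b (config (enter , q) i ws) (maybe′ (λ v → P (vs [ t ]≔ v)) ⊥ (natStep o (lookup vs t))))
        ws≡ (behaves-touch ws t (home bs e) nothing right (λ ())
              (fits-[]≔ ws t ws-fits (≤-trans (cells-home bs e) (roomy _ length≤)))
              eq
              (subst₂ (λ T → Behaves b (At operate T))
                (sym (right-arriving [] nothing bs e))
                result≡
                (behaves-operate o (λ _ → refl) (λ bs′ → P (vs [ t ]≔ value bs′)) [] bs e (roomy _ length≤)
                  λ bs′ e′ bs-steps → after _ _ (counters-[]≔ ws vs t cs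
                    (counter-step o bs e′ value≡ value≤ length≤ bs-steps (nat-steps bs-steps))))))
      where
      ws-fits : Fits b ws
      ws-fits = counters-fit ws vs cs
      open Operation entry-q i ws ws-fits
      ws≡ : ws [ t ]≔ home bs e ≡ ws
      ws≡ = trans (cong (ws [ t ]≔_) (sym tape≡)) (Vec.[]≔-lookup ws t)
      nat-steps : ∀ {bs′} → bitStep o bs ≡ just bs′ → natStep o (lookup vs t) ≡ just (value bs′)
      nat-steps bs-steps = trans (cong (natStep o) (sym value≡))
        (trans (sym (bitStep-value o bs)) (cong (Maybe.map value) bs-steps))
      result≡ : maybe′ (λ bs′ → P (vs [ t ]≔ value bs′)) ⊥ (bitStep o bs) ≡
                maybe′ (λ v → P (vs [ t ]≔ v)) ⊥ (natStep o (lookup vs t))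
      result≡ = trans (sym (Maybe.maybe′-map (λ v → P (vs [ t ]≔ v)) ⊥ value (bitStep o bs)))
        (cong (maybe′ (λ v → P (vs [ t ]≔ v)) ⊥) (trans (bitStep-value o bs) (cong (natStep o) value≡)))
      eq : ∀ s → next (enter , q) (head i) (Vec.map head (ws [ t ]≔ home bs e)) s ≡
                 just (touch (operate , q) (Vec.map head (ws [ t ]≔ home bs e)) t nothing right)
      eq s rewrite entry-q | scanned (home bs e) = refl

    -- The accepting paths from a ready configuration are the accepting runs of the
    -- automaton.  One increment is kept in reserve for the operation at the end.
    behaves-run : ∀ w q ls ws vs → Counters X (suc (length w)) ws vs →
      Behaves b (config (ready , just q) (reading ls w) ws) (Run q vs w)
    behaves-run [] q ls ws vs cs with ends q in ends-q
    ... | false = behaves-↔ (mk↔ₛ′ (λ ()) (λ ()) (λ ()) (λ ()))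
      (behaves-stuck (λ ()) (counters-fit ws vs cs) λ a ok →
        contradiction (trans (sym (eq (Action.nextState a))) (allowed⇒next (config (ready , just q) (reading ls []) ws) a ok)) λ ())
      where
      eq : ∀ s → next (ready , just q) rightEnd (Vec.map head ws) s ≡ nothing
      eq s rewrite ends-q = refl
    ... | true = behaves-↔ (mk↔ₛ′ (tt ,_) proj₂ (λ _ → refl) (λ _ → refl))
      (behaves-idle stay (λ ()) (counters-fit ws vs cs) eq
        (behaves-enter nothing _ ws vs 0 (λ _ → ⊤) cs
          λ ws′ vs′ cs′ → behaves-accept refl (counters-fit ws′ vs′ cs′)))
      where
      eq : ∀ s → next (ready , just q) rightEnd (Vec.map head ws) s ≡
                 just (idle (enter , nothing) stay (Vec.map head ws))
      eq s rewrite ends-q = refl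
    behaves-run (c ∷ w) q ls ws vs cs =
      behaves-↔ Σ-assoc (behaves-node (λ ()) (counters-fit ws vs cs) choices λ (q′ , _) →
        subst₂ (λ i ws′ → Behaves b (config (enter , just q′) i ws′)
                  (After (entry (just q′)) vs (λ vs′ → Run q′ vs′ w)))
          (sym (right-reading ls (bit c) w)) (sym (stay-put ws))
          (behaves-enter (just q′) _ ws vs (suc (length w)) _ cs
            λ ws′ vs′ → behaves-run w q′ (bit c ∷ ls) ws′ vs′))
      where
      cfg : Config
      cfg = config (ready , just q) (reading ls (c ∷ w)) ws

      into : Q → Act
      into q′ = idle (enter , just q′) right (Vec.map head ws)

      -- The actions possible on reading c correspond to the states that may follow q.
      choices : (Σ[ q′ ∈ Q ] T (goes q c q′)) ↔ (Σ[ a ∈ Act ] T (allowed cfg a))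
      choices = mk↔ₛ′
        (λ (q′ , ok) → into q′ , next⇒allowed cfg (into q′) (into-ok q′ ok))
        (λ (a , ok) → proj₁ (chosen a (allowed⇒next cfg a ok)))
        (λ (a , ok) → same (proj₂ (chosen a (allowed⇒next cfg a ok))))
        (λ (q′ , ok) → same′ (into-injective (proj₂ (chosen (into q′) _))))
        where
        into-ok : ∀ q′ → T (goes q c q′) → next (ready , just q) (bit c) (Vec.map head ws) (enter , just q′) ≡ just (into q′)
        into-ok q′ ok with goes q c q′
        ... | true = refl

        chosen : ∀ a → next (ready , just q) (bit c) (Vec.map head ws) (Action.nextState a) ≡ just a →
                 Σ[ (q′ , _) ∈ Σ[ q′ ∈ Q ] T (goes q c q′) ] into q′ ≡ a
        chosen (action (enter , just q′) _ _ _) eq with goes q c q′ in goes-q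
        ... | true = (q′ , subst T (sym goes-q) tt) , Maybe.just-injective eq

        into-injective : ∀ {q₁ q₂} → into q₁ ≡ into q₂ → q₁ ≡ q₂
        into-injective refl = refl

        same : ∀ {a a′ : Act} {ok : T (allowed cfg a)} {ok′ : T (allowed cfg a′)} → a ≡ a′ → (a , ok) ≡ (a′ , ok′)
        same {a} {ok = ok} {ok′} refl = cong (a ,_) (T-irrelevant {allowed cfg a} ok ok′)

        same′ : ∀ {q₁ q₂ : Q} {ok : T (goes q c q₁)} {ok′ : T (goes q c q₂)} → q₁ ≡ q₂ → (q₁ , ok) ≡ (q₂ , ok′)
        same′ {q₁} refl = cong (q₁ ,_) (T-irrelevant _ _)

    behaves-initial : ∀ x → suc (length x) ≤ X →
      Behaves b (initial x) (Run start (replicate K 0) x)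
    behaves-initial x x≤X =
      behaves-idle right (λ ()) (counters-fit (replicate K _) (replicate K 0) zeros) (λ _ → refl)
        (subst (λ i → Behaves b (config (ready , just start) i (replicate K (home [] false)))
                        (Run start (replicate K 0) x))
          (sym (right-reading [] leftEnd x))
          (behaves-run x start _ _ _ zeros))
      where
      zeros : Counters X (suc (length x)) (replicate K (home [] false)) (replicate K 0)
      zeros t rewrite Vec.lookup-replicate t (home [] false) | Vec.lookup-replicate t 0 =
        counter [] false refl refl x≤X (≤-trans (≤-trans (s≤s z≤n) x≤X) (m≤m+n X _))

  -- The number of accepting runs.
  accepted : Word → ℕ
  accepted x = proj₁ (finite-Run start (replicate K 0) x)

  -- Cells per work tape on an input of length l.
  room : ℕ → ℕ
  room l = 2 + ⌊log₂ 2 * suc l ⌋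

  behaves : ∀ x → Behaves (room (length x)) (initial x) (Run start (replicate K 0) x)
  behaves x = Simulation.behaves-initial roomy x ≤-refl
    where
    roomy : ∀ l → 2 ^ l ≤ 2 * suc (length x) → l + 2 ≤ room (length x)
    roomy l l≤ = begin
      l + 2             ≡⟨ +-comm l 2 ⟩
      2 + l             ≡⟨ cong (2 +_) (⌊log₂[2^n]⌋≡n l) ⟨
      2 + ⌊log₂ 2 ^ l ⌋ ≤⟨ +-monoʳ-≤ 2 (⌊log₂⌋-mono-≤ l≤) ⟩
      room (length x)   ∎
      where open ≤-Reasoning

  -- The inequalities come from suc l ≤ 2 * l and 1 ≤ ⌊log₂ l ⌋.
  room-≤ : ∀ l → 2 ≤ l → room l ≤ 5 * ⌊log₂ l ⌋
  room-≤ l@(suc _) 2≤l = begin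
    2 + ⌊log₂ 2 * suc l ⌋    ≡⟨ cong (2 +_) (⌊log₂[2*b]⌋≡1+⌊log₂b⌋ (suc l)) ⟩
    3 + ⌊log₂ suc l ⌋        ≤⟨ +-monoʳ-≤ 3 (⌊log₂⌋-mono-≤ (+-mono-≤ {1} {l} (≤-trans (n≤1+n 1) 2≤l) (m≤m+n l 0))) ⟩
    3 + ⌊log₂ 2 * l ⌋        ≡⟨ cong (3 +_) (⌊log₂[2*b]⌋≡1+⌊log₂b⌋ l) ⟩
    4 + ⌊log₂ l ⌋            ≡⟨ +-comm 4 ⌊log₂ l ⌋ ⟩
    ⌊log₂ l ⌋ + 4            ≤⟨ +-monoʳ-≤ ⌊log₂ l ⌋ (*-monoʳ-≤ 4 (⌊log₂⌋-mono-≤ 2≤l)) ⟩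
    5 * ⌊log₂ l ⌋            ∎
    where open ≤-Reasoning

  workSpace-≤ : ∀ {b k} (ws : Vec (Tape Γ) k) → (∀ t → cells (lookup ws t) ≤ b) →
                Vec.sum (Vec.map cells ws) ≤ k * b
  workSpace-≤ []       ws-fits = z≤n
  workSpace-≤ (w ∷ ws) ws-fits = +-mono-≤ (ws-fits zero) (workSpace-≤ ws (ws-fits ∘ suc))

  accepted∈#L : accepted ∈#L
  accepted∈#L = record
    { machine  = machine
    ; logSpace = K * 5 , 2 , λ x 2≤∣x∣ c path → begin
        workSpace c                    ≤⟨ workSpace-≤ (Configuration.work c) (Behaves.fits (behaves x) c path) ⟩
        K * room (length x)            ≤⟨ *-monoʳ-≤ K (room-≤ (length x) 2≤∣x∣) ⟩
        K * (5 * ⌊log₂ length x ⌋)     ≡⟨ *-assoc K 5 _ ⟨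
        K * 5 * ⌊log₂ length x ⌋       ∎
    ; halts    = λ x → Behaves.halts (behaves x)
    ; counts   = λ x → proj₂ (finite-Run start (replicate K 0) x) ↔-∘ Behaves.counts (behaves x)
    }
    where open ≤-Reasoning hiding (start)

-- Rows as ordered choices of columns

-- Arbitrary entries, or entries 0 and 1 only.
data Rule : Set where
  natural binary : Rule

Entry : Rule → ℕ → Set
Entry natural a = ⊤
Entry binary  a = a ≡ 0 ⊎ a ≡ 1

Entry-irrelevant : ∀ ρ {a} (p q : Entry ρ a) → p ≡ q
Entry-irrelevant natural p q = refl
Entry-irrelevant binary (inj₁ p) (inj₁ q) = cong inj₁ (uip p q)
Entry-irrelevant binary (inj₂ p) (inj₂ q) = cong inj₂ (uip p q)
Entry-irrelevant binary (inj₁ refl) (inj₂ ())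
Entry-irrelevant binary (inj₂ refl) (inj₁ ())

Entry-0 : ∀ ρ → Entry ρ 0
Entry-0 natural = tt
Entry-0 binary  = inj₁ refl

-- One more unit in column j.
bump : ∀ {m} → Vec ℕ m → Fin m → Vec ℕ m
bump v j = v [ j ]≔ suc (lookup v j)

sum-bump : ∀ {m} (v : Vec ℕ m) j → sum (bump v j) ≡ suc (sum v)
sum-bump (x ∷ v) zero    = refl
sum-bump (x ∷ v) (suc j) = trans (cong (x +_) (sum-bump v j)) (+-suc x (sum v))

_⊕_ : ∀ {m} → Vec ℕ m → Vec ℕ m → Vec ℕ m
_⊕_ = zipWith _+_

bump-⊕ : ∀ {m} (u v : Vec ℕ m) j → bump u j ⊕ v ≡ u ⊕ bump v j
bump-⊕ (x ∷ u) (y ∷ v) zero    = cong (_∷ (u ⊕ v)) (sym (+-suc x y))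
bump-⊕ (x ∷ u) (y ∷ v) (suc j) = cong (x + y ∷_) (bump-⊕ u v j)

-- Column j is not before the threshold ℓ.  The threshold ranges up to m, where no
-- column is usable.
usable : ∀ {m} → Fin (suc m) → Fin m → Bool
usable zero    j       = true
usable (suc ℓ) zero    = false
usable (suc ℓ) (suc j) = usable ℓ j

-- The first column that may be chosen after column j: j again if entries are
-- arbitrary, the next one if they are at most 1.
threshold : ∀ {m} → Rule → Fin m → Fin (suc m)
threshold natural = inject₁
threshold binary  = suc

threshold-suc : ∀ {m} ρ (j : Fin m) → threshold ρ (suc j) ≡ suc (threshold ρ j)
threshold-suc natural j = refl
threshold-suc binary  j = refl

-- The entries obey the rule and those before the threshold vanish.
Supported : ∀ {m} → Rule → Fin (suc m) → Vec ℕ m → Set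
Supported ρ ℓ       []      = ⊤
Supported ρ zero    (x ∷ v) = Entry ρ x × Supported ρ zero v
Supported ρ (suc ℓ) (x ∷ v) = x ≡ 0 × Supported ρ ℓ v

Supported-irrelevant : ∀ {m} ρ ℓ (v : Vec ℕ m) (p q : Supported ρ ℓ v) → p ≡ q
Supported-irrelevant ρ ℓ       []      p q = refl
Supported-irrelevant ρ zero    (x ∷ v) (p , ps) (q , qs) =
  cong₂ _,_ (Entry-irrelevant ρ p q) (Supported-irrelevant ρ zero v ps qs)
Supported-irrelevant ρ (suc ℓ) (x ∷ v) (p , ps) (q , qs) =
  cong₂ _,_ (uip p q) (Supported-irrelevant ρ ℓ v ps qs)

Supported-0 : ∀ {m} ρ ℓ → Supported ρ ℓ (replicate m 0)
Supported-0 {zero}  ρ ℓ       = tt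
Supported-0 {suc m} ρ zero    = Entry-0 ρ , Supported-0 ρ zero
Supported-0 {suc m} ρ (suc ℓ) = refl , Supported-0 ρ ℓ

sum-0 : ∀ m → sum (replicate m 0) ≡ 0
sum-0 zero    = refl
sum-0 (suc m) = sum-0 m

sum≡0⇒0 : ∀ {m} (v : Vec ℕ m) → sum v ≡ 0 → replicate m 0 ≡ v
sum≡0⇒0 []         eq = refl
sum≡0⇒0 (zero ∷ v) eq = cong (0 ∷_) (sum≡0⇒0 v eq)

Supported-bump : ∀ {m} ρ ℓ j (v : Vec ℕ m) → T (usable ℓ j) →
  Supported ρ (threshold ρ j) v → Supported ρ ℓ (bump v j)
Supported-bump natural zero    zero    (x ∷ v) _ (_ , sv)    = tt , sv
Supported-bump binary  zero    zero    (x ∷ v) _ (refl , sv) = inj₂ refl , sv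
Supported-bump ρ       ℓ       (suc j) (x ∷ v) ok sv with threshold ρ (suc j) | threshold-suc ρ j
Supported-bump ρ       zero    (suc j) (x ∷ v) ok (refl , sv) | _ | refl =
  Entry-0 ρ , Supported-bump ρ zero j v _ sv
Supported-bump ρ       (suc ℓ) (suc j) (x ∷ v) ok (refl , sv) | _ | refl =
  refl , Supported-bump ρ ℓ j v ok sv

-- The column j is the first one with a nonzero entry.
Supported-unbump : ∀ {m} ρ ℓ (v : Vec ℕ m) {a} → Supported ρ ℓ v → sum v ≡ suc a →
  ∃[ j ] T (usable ℓ j) × ∃[ u ] Supported ρ (threshold ρ j) u × bump u j ≡ v
Supported-unbump natural zero (suc x ∷ v) (_ , sv)         eq = zero , tt , (x ∷ v) , (tt , sv) , refl
Supported-unbump binary  zero (suc .0 ∷ v) (inj₂ refl , sv) eq = zero , tt , (0 ∷ v) , (refl , sv) , refl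
Supported-unbump ρ zero (zero ∷ v) (_ , sv) eq with Supported-unbump ρ zero v sv eq
... | j , ok , u , su , refl =
  suc j , tt , (0 ∷ u) , subst (λ ℓ → Supported ρ ℓ (0 ∷ u)) (sym (threshold-suc ρ j)) (refl , su) , refl
Supported-unbump ρ (suc ℓ) (.0 ∷ v) (refl , sv) eq with Supported-unbump ρ ℓ v sv eq
... | j , ok , u , su , refl =
  suc j , ok , (0 ∷ u) , subst (λ ℓ → Supported ρ ℓ (0 ∷ u)) (sym (threshold-suc ρ j)) (refl , su) , refl

-- Both columns are the first nonzero ones of the common result.
bump-injective : ∀ {m} ρ (i j : Fin m) u v → Supported ρ (threshold ρ i) u → Supported ρ (threshold ρ j) v →
  bump u i ≡ bump v j → i ≡ j × u ≡ v
bump-injective ρ zero zero (x ∷ u) (y ∷ v) su sv eq with Vec.∷-injective eq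
... | refl , refl = refl , refl
bump-injective ρ zero (suc j) (x ∷ u) (y ∷ v) su sv eq with threshold ρ (suc j) | threshold-suc ρ j
bump-injective ρ zero (suc j) (x ∷ u) (y ∷ v) su (refl , sv) () | _ | refl
bump-injective ρ (suc i) zero (x ∷ u) (y ∷ v) su sv eq with threshold ρ (suc i) | threshold-suc ρ i
bump-injective ρ (suc i) zero (x ∷ u) (y ∷ v) (refl , su) sv () | _ | refl
bump-injective ρ (suc i) (suc j) (x ∷ u) (y ∷ v) su sv eq
  with threshold ρ (suc i) | threshold-suc ρ i | threshold ρ (suc j) | threshold-suc ρ j
bump-injective ρ (suc i) (suc j) (x ∷ u) (y ∷ v) (refl , su) (refl , sv) eq | _ | refl | _ | refl
  with bump-injective ρ i j u v su sv (Vec.∷-injectiveʳ eq)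
... | refl , refl = refl , refl

IsRow : ∀ {m} → Rule → Fin (suc m) → ℕ → Vec ℕ m → Set
IsRow ρ ℓ a v = Supported ρ ℓ v × sum v ≡ a

IsRow-irrelevant : ∀ {m} ρ ℓ a (v : Vec ℕ m) (p q : IsRow ρ ℓ a v) → p ≡ q
IsRow-irrelevant ρ ℓ a v (p , p′) (q , q′) = cong₂ _,_ (Supported-irrelevant ρ ℓ v p q) (uip p′ q′)

-- The rows with sum a that are supported from ℓ on.
Row : ∀ {m} → Rule → Fin (suc m) → ℕ → Set
Row {m} ρ ℓ a = Σ[ v ∈ Vec ℕ m ] IsRow ρ ℓ a v

Row-≡ : ∀ {m ρ ℓ a} {r s : Row {m} ρ ℓ a} → proj₁ r ≡ proj₁ s → r ≡ s
Row-≡ {r = v , p} {.v , q} refl = cong (v ,_) (IsRow-irrelevant _ _ _ v p q)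

row-zero : ∀ {m ρ} ℓ → Row {m} ρ ℓ 0 ↔ ⊤
row-zero {m} {ρ} ℓ = mk↔ₛ′ _ (λ _ → replicate m 0 , Supported-0 ρ ℓ , sum-0 m) (λ _ → refl)
  (λ (v , sv , eq) → Row-≡ (sum≡0⇒0 v eq))

-- A nonzero row amounts to the choice of its first nonzero column j together with
-- the row left after taking one unit from column j.
row-suc : ∀ {m ρ} ℓ a → Row {m} ρ ℓ (suc a) ↔ (Σ[ j ∈ Fin m ] T (usable ℓ j) × Row ρ (threshold ρ j) a)
row-suc {m} {ρ} ℓ a = mk↔ₛ′ remove insert remove-insert (λ r → Row-≡ (bump-remove r))
  where
  Choice = Σ[ j ∈ Fin m ] T (usable ℓ j) × Row {m} ρ (threshold ρ j) a

  remove : Row ρ ℓ (suc a) → Choice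
  remove (v , sv , eq) with Supported-unbump ρ ℓ v sv eq
  ... | j , ok , u , su , refl = j , ok , u , su , suc-injective (trans (sym (sum-bump u j)) eq)

  insert : Choice → Row ρ ℓ (suc a)
  insert (j , ok , u , su , eq) =
    bump u j , Supported-bump ρ ℓ j u ok su , trans (sum-bump u j) (cong suc eq)

  bump-remove : ∀ r → bump (proj₁ (proj₂ (proj₂ (remove r)))) (proj₁ (remove r)) ≡ proj₁ r
  bump-remove (v , sv , eq) with Supported-unbump ρ ℓ v sv eq
  ... | j , ok , u , su , refl = refl

  same : ∀ {c d : Choice} → proj₁ c ≡ proj₁ d × proj₁ (proj₂ (proj₂ c)) ≡ proj₁ (proj₂ (proj₂ d)) → c ≡ d
  same {j , ok , u , p} {.j , ok′ , .u , q} (refl , refl) =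
    cong (j ,_) (cong₂ _,_ (T-irrelevant ok ok′) (Row-≡ refl))

  remove-insert : ∀ c → remove (insert c) ≡ c
  remove-insert c@(j , ok , u , su , eq) =
    let (i , _ , v , sv , _) = remove (insert c)
    in same (bump-injective ρ i j v u sv su (bump-remove (insert c)))

-- Tables row by row

-- Tables with row sums α that, added to the column sums u of earlier rows, give
-- the column sums β; built one row after the other.
Tables : ∀ {n m} → Rule → Vec ℕ m → Vec ℕ n → Vec ℕ m → Set
Tables ρ u []      β = u ≡ β
Tables ρ u (a ∷ α) β = Σ[ r ∈ Row ρ zero a ] Tables ρ (u ⊕ proj₁ r) α β

colSums : ∀ {n m} → Matrix n m → Vec ℕ m
colSums A = Vec.map sum (Vec.transpose A)

colSums-[] : ∀ m → colSums {0} {m} [] ≡ replicate m 0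
colSums-[] m = Vec.map-replicate sum [] m

colSums-∷ : ∀ {n m} (v : Vec ℕ m) (A : Matrix n m) → colSums (v ∷ A) ≡ v ⊕ colSums A
colSums-∷ v A = sums v (Vec.transpose A)
  where
  sums : ∀ {n m} (v : Vec ℕ m) (B : Matrix m n) →
         Vec.map sum ((replicate m _∷_ Vec.⊛ v) Vec.⊛ B) ≡ v ⊕ Vec.map sum B
  sums []      []      = refl
  sums (x ∷ v) (b ∷ B) = cong (x + sum b ∷_) (sums v B)

-- The same condition on a matrix.
IsTable : ∀ {n m} → Rule → Vec ℕ m → Vec ℕ n → Vec ℕ m → Matrix n m → Set
IsTable ρ u α β A = Vec.map sum A ≡ α × u ⊕ colSums A ≡ β × All (All (Entry ρ)) A

IsTable-irrelevant : ∀ {n m} ρ (u : Vec ℕ m) (α : Vec ℕ n) β A (p q : IsTable ρ u α β A) → p ≡ q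
IsTable-irrelevant ρ u α β A (p₁ , p₂ , p₃) (q₁ , q₂ , q₃) =
  cong₂ _,_ (uip p₁ q₁) (cong₂ _,_ (uip p₂ q₂) (All.irrelevant (All.irrelevant (Entry-irrelevant ρ)) p₃ q₃))

supported⇒entries : ∀ {m} ρ (v : Vec ℕ m) → Supported ρ zero v → All (Entry ρ) v
supported⇒entries ρ []      sv        = []
supported⇒entries ρ (x ∷ v) (sx , sv) = sx ∷ supported⇒entries ρ v sv

entries⇒supported : ∀ {m} ρ (v : Vec ℕ m) → All (Entry ρ) v → Supported ρ zero v
entries⇒supported ρ []      []        = tt
entries⇒supported ρ (x ∷ v) (sx ∷ sv) = sx , entries⇒supported ρ v sv

⊕-identityʳ : ∀ {m} (u : Vec ℕ m) → u ⊕ replicate m 0 ≡ u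
⊕-identityʳ = Vec.zipWith-identityʳ +-identityʳ

⊕-identityˡ : ∀ {m} (u : Vec ℕ m) → replicate m 0 ⊕ u ≡ u
⊕-identityˡ = Vec.zipWith-identityˡ +-identityˡ

⊕-colSums : ∀ {n m} (u v : Vec ℕ m) (A : Matrix n m) → u ⊕ colSums (v ∷ A) ≡ (u ⊕ v) ⊕ colSums A
⊕-colSums u v A = trans (cong (u ⊕_) (colSums-∷ v A)) (sym (Vec.zipWith-assoc +-assoc u v (colSums A)))

Tables-↔ : ∀ {n m} ρ (u : Vec ℕ m) (α : Vec ℕ n) β →
  Tables ρ u α β ↔ (Σ[ A ∈ Matrix n m ] IsTable ρ u α β A)
Tables-↔ {m = m} ρ u [] β = mk↔ₛ′
  (λ u≡β → [] , refl , trans (cong (u ⊕_) (colSums-[] m)) (trans (⊕-identityʳ u) u≡β) , [])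
  (λ { ([] , _ , eq , _) → trans (sym (trans (cong (u ⊕_) (colSums-[] m)) (⊕-identityʳ u))) eq })
  (λ { ([] , p) → cong ([] ,_) (IsTable-irrelevant ρ u [] β [] _ p) })
  (λ _ → uip _ _)
Tables-↔ {suc n} {m} ρ u (a ∷ α) β =
  mk↔ₛ′ join split join-split split-join ↔-∘ Σ-↔ (↔-id _) (λ {r} → Tables-↔ ρ (u ⊕ proj₁ r) α β)
  where
  Split = Σ[ r ∈ Row {m} ρ zero a ] Σ[ A ∈ Matrix n m ] IsTable ρ (u ⊕ proj₁ r) α β A
  Joint = Σ[ A ∈ Matrix (suc n) m ] IsTable ρ u (a ∷ α) β A

  join : Split → Joint
  join ((v , sv , v-sum) , A , A-sums , A-cols , A-entries) =
    v ∷ A , cong₂ _∷_ v-sum A-sums , trans (⊕-colSums u v A) A-cols , supported⇒entries ρ v sv ∷ A-entries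

  split : Joint → Split
  split (v ∷ A , sums , cols , v-entries ∷ A-entries) =
    (v , entries⇒supported ρ v v-entries , Vec.∷-injectiveˡ sums) ,
    A , Vec.∷-injectiveʳ sums , trans (sym (⊕-colSums u v A)) cols , A-entries

  join-split : ∀ t → join (split t) ≡ t
  join-split (v ∷ A , sums , cols , v-entries ∷ A-entries) =
    cong (v ∷ A ,_) (IsTable-irrelevant ρ u (a ∷ α) β (v ∷ A) _ _)

  split-join : ∀ s → split (join s) ≡ s
  split-join ((v , v-row) , A , A-table) = same _ v-row _ A-table
    where
    same : ∀ (p q : IsRow ρ zero a v) (p′ q′ : IsTable ρ (u ⊕ v) α β A) →
           _≡_ {A = Split} ((v , p) , A , p′) ((v , q) , A , q′)
    same p q p′ q′ with IsRow-irrelevant ρ zero a v p q | IsTable-irrelevant ρ (u ⊕ v) α β A p′ q′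
    ... | refl | refl = refl

Contingency : Rule → ∀ {n m} → Vec ℕ n → Vec ℕ m → Set
Contingency natural = CT
Contingency binary  = CT₀

Contingency-↔ : ∀ ρ {n m} (α : Vec ℕ n) (β : Vec ℕ m) →
  Contingency ρ α β ↔ Tables ρ (replicate m 0) α β
Contingency-↔ ρ {n} {m} α β = ↔-sym (Tables-↔ ρ _ α β) ↔-∘ asTable ρ
  where
  table-≡ : ∀ {A B : CT α β} → CT.entries A ≡ CT.entries B → A ≡ B
  table-≡ {table A p q} {table .A p′ q′} refl = cong₂ (table A) (uip p p′) (uip q q′)

  asTable : ∀ ρ → Contingency ρ α β ↔ (Σ[ A ∈ Matrix n m ] IsTable ρ (replicate m 0) α β A)
  asTable natural = mk↔ₛ′
    (λ (table A rows cols) → A , rows , trans (⊕-identityˡ _) cols , All.universal (All.universal _) A)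
    (λ (A , rows , cols , _) → table A rows (trans (sym (⊕-identityˡ _)) cols))
    (λ (A , _) → cong (A ,_) (IsTable-irrelevant natural _ α β A _ _))
    (λ _ → table-≡ refl)
  asTable binary = mk↔ₛ′
    (λ (table A rows cols , entries) → A , rows , trans (⊕-identityˡ _) cols , entries)
    (λ (A , rows , cols , entries) → table A rows (trans (sym (⊕-identityˡ _)) cols) , entries)
    (λ (A , _) → cong (A ,_) (IsTable-irrelevant binary _ α β A _ _))
    (λ (A , entries) → cong (λ cols → table _ _ cols , entries) (uip _ _))

-- Unary words and final segments of columns

-- The part of a unary list after its first entry.
more : List ℕ → Word
more []       = []
more (b ∷ bs) = false ∷ ones b ++ more bs

listUnary : List ℕ → Word
listUnary []       = []
listUnary (b ∷ bs) = ones b ++ more bs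

unary≡ : ∀ {k} (v : Vec ℕ k) → unary v ≡ listUnary (Vec.toList v)
unary≡ []          = refl
unary≡ (x ∷ [])    = sym (List.++-identityʳ (ones x))
unary≡ (x ∷ y ∷ v) = cong (λ w → ones x ++ false ∷ w) (unary≡ (y ∷ v))

-- The word for a sequence of rows, each ended by a 0, followed by w.
blocks : ∀ {k} → Vec ℕ k → Word → Word
blocks []      w = w
blocks (a ∷ α) w = ones a ++ false ∷ blocks α w

unary-blocks : ∀ {k} a (α : Vec ℕ k) w → unary (a ∷ α) ++ false ∷ w ≡ blocks (a ∷ α) w
unary-blocks a []      w = refl
unary-blocks a (b ∷ α) w = trans (List.++-assoc (ones a) (false ∷ unary (b ∷ α)) (false ∷ w))
  (cong (λ w → ones a ++ false ∷ w) (unary-blocks b α w))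

-- The entries from position ℓ on.
columnsFrom : ∀ {k} → Fin (suc k) → Vec ℕ k → List ℕ
columnsFrom zero    v       = Vec.toList v
columnsFrom (suc ℓ) (x ∷ v) = columnsFrom ℓ v

columnsFrom-inject₁ : ∀ {k} (j : Fin k) v → columnsFrom (inject₁ j) v ≡ lookup v j ∷ columnsFrom (suc j) v
columnsFrom-inject₁ zero    (x ∷ v) = refl
columnsFrom-inject₁ (suc j) (x ∷ v) = columnsFrom-inject₁ j v

columnsFrom-fromℕ : ∀ {k} (v : Vec ℕ k) → columnsFrom (fromℕ k) v ≡ []
columnsFrom-fromℕ []      = refl
columnsFrom-fromℕ (x ∷ v) = columnsFrom-fromℕ v

columnsFrom-[]≔ : ∀ {k} (j : Fin k) v x → columnsFrom (suc j) (v [ j ]≔ x) ≡ columnsFrom (suc j) v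
columnsFrom-[]≔ zero    (y ∷ v) x = refl
columnsFrom-[]≔ (suc j) (y ∷ v) x = columnsFrom-[]≔ j v x

-- The last position, or one that is the index of an entry.
top? : ∀ {k} (ℓ : Fin (suc k)) → ℓ ≡ fromℕ k ⊎ ∃[ i ] ℓ ≡ inject₁ i
top? ℓ with view ℓ
... | ‵fromℕ     = inj₁ refl
... | ‵inject₁ i = inj₂ (i , refl)

Positive : List ℕ → Set
Positive = ListAll.All (1 ≤_)

∷-×-↔ : {x y : ℕ} {xs ys : List ℕ} → (x ≡ y × xs ≡ ys) ↔ (x ∷ xs ≡ y ∷ ys)
∷-×-↔ = mk↔ₛ′ (λ { (refl , refl) → refl }) (λ { refl → refl , refl })
               (λ { refl → refl }) (λ { (refl , refl) → refl })

toList-↔ : ∀ {k} (u v : Vec ℕ k) → (Vec.toList u ≡ Vec.toList v) ↔ (u ≡ v)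
toList-↔ u v = prop-↔ uip uip
  (λ eq → trans (sym (Vec.cast-is-id refl u)) (Vec.toList-injective refl u v eq)) (cong Vec.toList)

-- The automaton for contingency tables

-- The control states, named for what has just been read:
--   count    a 1 of the initial block 1^n (or nothing)
--   gap      the first 0 after this block
--   rows     the second 0 after this block
--   noRows   the 0 following rows, which leads to acceptance only for n = 0
--   row j    a 1 of a row sum, assigned to column j
--   rowEnd   the 0 that ends a row sum
--   colGap ℓ the 0 before the column sum of index ℓ, all earlier ones being complete
--   col j    a 1 of the column sum of index j
data Control (m : ℕ) : Set where
  count gap rows noRows rowEnd : Control m
  row    : Fin m → Control m
  colGap : Fin (suc m) → Control m
  col    : Fin m → Control m

finite-Control : ∀ m → Finite (Control m)
finite-Control m = finite-↔
  (mk↔ₛ′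
    (λ { count → inj₁ 0F ; gap → inj₁ 1F ; rows → inj₁ 2F ; noRows → inj₁ 3F ; rowEnd → inj₁ 4F
       ; (row j) → inj₂ (inj₁ j) ; (colGap ℓ) → inj₂ (inj₂ (inj₁ ℓ)) ; (col j) → inj₂ (inj₂ (inj₂ j)) })
    (λ { (inj₁ 0F) → count ; (inj₁ 1F) → gap ; (inj₁ 2F) → rows ; (inj₁ 3F) → noRows ; (inj₁ 4F) → rowEnd
       ; (inj₂ (inj₁ j)) → row j ; (inj₂ (inj₂ (inj₁ ℓ))) → colGap ℓ ; (inj₂ (inj₂ (inj₂ j))) → col j })
    (λ { (inj₁ 0F) → refl ; (inj₁ 1F) → refl ; (inj₁ 2F) → refl ; (inj₁ 3F) → refl ; (inj₁ 4F) → refl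
       ; (inj₂ (inj₁ j)) → refl ; (inj₂ (inj₂ (inj₁ ℓ))) → refl ; (inj₂ (inj₂ (inj₂ j))) → refl })
    (λ { count → refl ; gap → refl ; rows → refl ; noRows → refl ; rowEnd → refl
       ; (row j) → refl ; (colGap ℓ) → refl ; (col j) → refl }))
  (finite-⊎ (finite-Fin 5) (finite-⊎ (finite-Fin m) (finite-⊎ (finite-Fin (suc m)) (finite-Fin m))))

module Marginal (ρ : Rule) (m : ℕ) where

  -- A 0 right after rows or rowEnd ends the list of rows, and no 0 may follow right
  -- after colGap, so no part is empty.
  follows : Control m → Bool → Control m → Bool
  follows count      true  count         = true
  follows count      false gap           = true
  follows gap        false rows          = true
  follows rows       true  (row j)       = true
  follows rows       false noRows        = true
  follows noRows     false (colGap zero) = true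
  follows (row i)    true  (row j)       = usable (threshold ρ i) j
  follows (row i)    false rowEnd        = true
  follows rowEnd     true  (row j)       = true
  follows rowEnd     false (colGap zero) = true
  follows (colGap ℓ) true  (col j)       = ⌊ ℓ Fin.≟ inject₁ j ⌋
  follows (col i)    true  (col j)       = ⌊ i Fin.≟ j ⌋
  follows (col i)    false (colGap ℓ)    = ⌊ suc i Fin.≟ ℓ ⌋
  follows _          _     _             = false

  -- The word ends in the last column sum, or with an empty list of column sums.
  mayEnd : Control m → Bool
  mayEnd (colGap ℓ) = ⌊ m ≟ 0 ⌋
  mayEnd (col j)    = ⌊ suc j Fin.≟ fromℕ m ⌋
  mayEnd _          = false

  -- Counter 0 holds the number of rows to come and counter 1 + j the current sum of
  -- column j.  Entering colGap ℓ tests counter ℓ: for ℓ = 0 that all rows have been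
  -- read, and otherwise that column ℓ - 1 is complete.  The end of the input tests
  -- the last counter, which for m = 0 is the row counter once more.
  effect : Maybe (Control m) → Maybe (Op × Fin (suc m))
  effect (just count)      = just (inc , zero)
  effect (just rowEnd)     = just (dec , zero)
  effect (just (row j))    = just (inc , suc j)
  effect (just (colGap ℓ)) = just (isZero , ℓ)
  effect (just (col j))    = just (dec , suc j)
  effect (just _)          = nothing
  effect nothing           = just (isZero , fromℕ m)

  automaton : CounterAutomaton
  automaton = record
    { Q       = Control m
    ; finiteQ = finite-Control m
    ; K       = suc m
    ; start   = count
    ; goes    = follows
    ; ends    = mayEnd
    ; entry   = effect
    }

  open CounterAutomaton automaton using (Run)

  -- Reading the column sums

  -- On a word of column sums the automaton is deterministic, and it accepts if and
  -- only if the remaining counters are the column sums.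
  col-↔ : ∀ b bs → Positive bs → ∀ j k (v : Vec ℕ m) →
    Run (col j) (k ∷ v) (ones b ++ more bs) ↔ (lookup v j ∷ columnsFrom (suc j) v ≡ b ∷ bs)
  colGap-↔ : ∀ b bs → 1 ≤ b → Positive bs → ∀ ℓ k (v : Vec ℕ m) →
    Run (colGap ℓ) (k ∷ v) (ones b ++ more bs) ↔ (columnsFrom ℓ v ≡ b ∷ bs)

  dec-↔ : ∀ b bs → Positive bs → ∀ j k (v : Vec ℕ m) →
    After (just (dec , suc j)) (k ∷ v) (λ vs → Run (col j) vs (ones b ++ more bs)) ↔
    (lookup v j ∷ columnsFrom (suc j) v ≡ suc b ∷ bs)
  dec-↔ b bs bs>0 j k v with lookup v j
  ... | zero  = both-empty (λ ()) (λ ())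
  ... | suc x = prop-↔ uip uip
      (λ eq → inc-head (trans (sym updated) eq)) (λ eq → trans updated (dec-head eq))
    ↔-∘ col-↔ b bs bs>0 j k (v [ j ]≔ x)
    where
    updated : lookup (v [ j ]≔ x) j ∷ columnsFrom (suc j) (v [ j ]≔ x) ≡ x ∷ columnsFrom (suc j) v
    updated = cong₂ _∷_ (Vec.lookup∘updateAt j v) (columnsFrom-[]≔ j v x)
    inc-head : ∀ {x y} {xs ys : List ℕ} → x ∷ xs ≡ y ∷ ys → _≡_ {A = List ℕ} (suc x ∷ xs) (suc y ∷ ys)
    inc-head refl = refl
    dec-head : ∀ {x y} {xs ys : List ℕ} → _≡_ {A = List ℕ} (suc x ∷ xs) (suc y ∷ ys) → x ∷ xs ≡ y ∷ ys
    dec-head refl = refl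

  col-↔ (suc b) bs bs>0 j k v =
    dec-↔ b bs bs>0 j k v ↔-∘
    unique-↔ (follows (col j) true) (col j) (fromWitness refl) (λ { (col j′) ok → cong col (toWitness ok) })
  col-↔ zero [] bs>0 j k v =
    prop-↔ (λ (ok , e , _) (ok′ , e′ , _) → cong₂ (λ ok e → ok , e , tt) (T-irrelevant ok ok′) (uip e e′)) uip
      (λ (last , v≡0 , _) → final (toWitness last) v≡0) unfinal
    ↔-∘ Σ-↔ (↔-id _) (isZero-↔ (fromℕ m) (k ∷ v) (λ _ → ⊤))
    where
    final : suc j ≡ fromℕ m → lookup (k ∷ v) (fromℕ m) ≡ 0 → lookup v j ∷ columnsFrom (suc j) v ≡ 0 ∷ []
    final last v≡0 = cong₂ _∷_ (trans (cong (lookup (k ∷ v)) last) v≡0)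
                               (trans (cong (λ ℓ → columnsFrom ℓ v) last) (columnsFrom-fromℕ v))
    unfinal : lookup v j ∷ columnsFrom (suc j) v ≡ 0 ∷ [] →
              T ⌊ suc j Fin.≟ fromℕ m ⌋ × lookup (k ∷ v) (fromℕ m) ≡ 0 × ⊤
    unfinal eq with top? (suc j)
    ... | inj₁ last = fromWitness last ,
                      trans (cong (lookup (k ∷ v)) (sym last)) (List.∷-injectiveˡ eq) , tt
    ... | inj₂ (i , e) = contradiction
      (trans (sym (columnsFrom-inject₁ i v)) (trans (cong (λ ℓ → columnsFrom ℓ v) (sym e)) (List.∷-injectiveʳ eq))) λ ()
  col-↔ zero (b ∷ bs) (b>0 ∷ bs>0) j k v =
    ∷-×-↔ ↔-∘
    (Σ-↔ (↔-id _) (≡⇒ (cong (_≡ b ∷ bs) (columnsFrom-[]≔ j v 0)) ↔-∘ colGap-↔ b bs b>0 bs>0 (suc j) k (v [ j ]≔ 0)) ↔-∘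
    (isZero-↔ (suc j) (k ∷ v) (λ vs → Run (colGap (suc j)) vs (ones b ++ more bs)) ↔-∘
    unique-↔ (follows (col j) false) (colGap (suc j)) (fromWitness refl)
      (λ { (colGap ℓ) ok → cong colGap (toWitness ok) })))

  colGap-↔ (suc b) bs _ bs>0 ℓ k v with top? ℓ
  ... | inj₁ refl = both-empty
      (λ { (col j , ok , _) → Fin.fromℕ≢inject₁ (toWitness ok) })
      (λ eq → contradiction (trans (sym (columnsFrom-fromℕ v)) eq) λ ())
  ... | inj₂ (j , refl) =
    ≡⇒ (cong (_≡ suc b ∷ bs) (sym (columnsFrom-inject₁ j v))) ↔-∘
    (dec-↔ b bs bs>0 j k v ↔-∘
    unique-↔ (follows (colGap (inject₁ j)) true) (col j) (fromWitness refl)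
      (λ { (col j′) ok → cong col (Fin.inject₁-injective (toWitness ok)) }))

  -- For an empty list of columns, the word ends already in state colGap zero.
  columns-↔ : ∀ (v β : Vec ℕ m) → All (1 ≤_) β → Run (colGap zero) (0 ∷ v) (unary β) ↔ (v ≡ β)
  columns-↔ v β β>0 rewrite unary≡ β =
    toList-↔ v β ↔-∘ go (Vec.toList β) (All.toList⁺ β>0) (Vec.length-toList β)
    where
    no-columns : ∀ {k} (v : Vec ℕ k) → k ≡ 0 → lookup (0 ∷ v) (fromℕ k) ≡ 0 × Vec.toList v ≡ []
    no-columns [] refl = refl , refl
    go : ∀ bs → Positive bs → length bs ≡ m → Run (colGap zero) (0 ∷ v) (listUnary bs) ↔ (Vec.toList v ≡ bs)
    go [] _ 0≡m =
      prop-↔ (λ (ok , e , _) (ok′ , e′ , _) → cong₂ (λ ok e → ok , e , tt) (T-irrelevant ok ok′) (uip e e′)) uip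
        (λ _ → proj₂ (no-columns v (sym 0≡m)))
        (λ _ → fromWitness (sym 0≡m) , proj₁ (no-columns v (sym 0≡m)) , tt)
      ↔-∘ Σ-↔ (↔-id _) (isZero-↔ (fromℕ m) (0 ∷ v) (λ _ → ⊤))
    go (b ∷ bs) (b>0 ∷ bs>0) _ = colGap-↔ b bs b>0 bs>0 zero 0 v

  -- Reading the rows

  -- The runs on a row sum 1^a correspond to the rows with sum a, and the run goes on
  -- with the column sums increased accordingly.
  row-↔ : ∀ a j k u w →
    Run (row j) (k ∷ u) (ones a ++ false ∷ w) ↔
    (Σ[ r ∈ Row ρ (threshold ρ j) a ] After (just (dec , zero)) (k ∷ u ⊕ proj₁ r) (λ vs → Run rowEnd vs w))

  choose-↔ : ∀ a ℓ k u w →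
    (Σ[ j ∈ Fin m ] T (usable ℓ j) × Run (row j) (k ∷ bump u j) (ones a ++ false ∷ w)) ↔
    (Σ[ r ∈ Row ρ ℓ (suc a) ] After (just (dec , zero)) (k ∷ u ⊕ proj₁ r) (λ vs → Run rowEnd vs w))
  choose-↔ a ℓ k u w =
    Σ-↔ (↔-sym (row-suc ℓ a)) (λ {(j , _ , v , _)} → ≡⇒ (cong P (bump-⊕ u v j))) ↔-∘
    (mk↔ₛ′ (λ (j , ok , r , p) → (j , ok , r) , p) (λ ((j , ok , r) , p) → j , ok , r , p) (λ _ → refl) (λ _ → refl) ↔-∘
    Σ-↔ (↔-id _) (λ {j} → Σ-↔ (↔-id _) (row-↔ a j k (bump u j) w)))
    where
    P : Vec ℕ m → Set
    P u = After (just (dec , zero)) (k ∷ u) (λ vs → Run rowEnd vs w)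

  row-↔ zero j k u w =
    ↔-sym (mk↔ₛ′ proj₂ (tt ,_) (λ _ → refl) (λ _ → refl) ↔-∘
      Σ-↔ (row-zero (threshold ρ j)) (λ {(v , _ , v-sum)} →
        ≡⇒ (cong P (trans (cong (u ⊕_) (sym (sum≡0⇒0 v v-sum))) (⊕-identityʳ u))))) ↔-∘
    unique-↔ (follows (row j) false) rowEnd tt (λ { rowEnd _ → refl })
    where
    P : Vec ℕ m → Set
    P u = After (just (dec , zero)) (k ∷ u) (λ vs → Run rowEnd vs w)
  row-↔ (suc a) j k u w = choose-↔ a (threshold ρ j) k u w ↔-∘
    mk↔ₛ′ (λ { (row i , ok , run) → i , ok , run }) (λ (i , ok , run) → row i , ok , run)
          (λ _ → refl) (λ { (row i , ok , run) → refl })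

  tables-↔ : ∀ {n} (α : Vec ℕ n) (β u : Vec ℕ m) → All (1 ≤_) α → All (1 ≤_) β →
    Run rowEnd (n ∷ u) (blocks α (false ∷ unary β)) ↔ Tables ρ u α β
  tables-↔ [] β u _ β>0 = columns-↔ u β β>0 ↔-∘
    unique-↔ (follows rowEnd false) (colGap zero) tt (λ { (colGap zero) _ → refl })
  tables-↔ {suc n} (suc a ∷ α) β u (_ ∷ α>0) β>0 =
    Σ-↔ (↔-id _) (tables-↔ α β _ α>0 β>0) ↔-∘
    (choose-↔ a zero (suc n) u (blocks α (false ∷ unary β)) ↔-∘
    mk↔ₛ′ (λ { (row i , ok , run) → i , ok , run }) (λ (i , ok , run) → row i , ok , run)
          (λ _ → refl) (λ { (row i , ok , run) → refl }))

  rows-↔ : ∀ {n} (α : Vec ℕ n) (β u : Vec ℕ m) → All (1 ≤_) α → All (1 ≤_) β →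
    Run rows (n ∷ u) (unary α ++ false ∷ false ∷ unary β) ↔ Tables ρ u α β
  rows-↔ [] β u _ β>0 = columns-↔ u β β>0 ↔-∘
    (unique-↔ (follows noRows false) (colGap zero) tt (λ { (colGap zero) _ → refl }) ↔-∘
    unique-↔ (follows rows false) noRows tt (λ { noRows _ → refl }))
  rows-↔ {suc n} (suc a ∷ α) β u α>0@(s≤s _ ∷ _) β>0 rewrite unary-blocks (suc a) α (false ∷ unary β) =
    tables-↔ (suc a ∷ α) β u α>0 β>0 ↔-∘
    mk↔ₛ′ (λ { (row i , ok , run) → row i , ok , run }) (λ { (row i , ok , run) → row i , ok , run })
          (λ { (row i , ok , run) → refl }) (λ { (row i , ok , run) → refl })

  count-↔ : ∀ n k u w → Run count (k ∷ u) (ones n ++ false ∷ false ∷ w) ↔ Run rows (n + k ∷ u) w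
  count-↔ zero k u w =
    unique-↔ (follows gap false) rows tt (λ { rows _ → refl }) ↔-∘
    unique-↔ (follows count false) gap tt (λ { gap _ → refl })
  count-↔ (suc n) k u w =
    ≡⇒ (cong (λ k → Run rows (k ∷ u) w) (+-suc n k)) ↔-∘
    (count-↔ n (suc k) u w ↔-∘
    unique-↔ (follows count true) count tt (λ { count _ → refl }))

  run-encode-↔ : ∀ (M : Marginals m) →
    Run count (replicate (suc m) 0) (encode M) ↔ Tables ρ (replicate m 0) (Marginals.α M) (Marginals.β M)
  run-encode-↔ M =
    rows-↔ α β _ αPositive βPositive ↔-∘
    (≡⇒ (cong (λ k → Run rows (k ∷ replicate m 0) (unary α ++ false ∷ false ∷ unary β)) (+-identityʳ n)) ↔-∘
    count-↔ n 0 _ _)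
    where open Marginals M

  -- Accepted words are encodings

  -- The column sums read are the counters with which the reading began.  A column
  -- sum after colGap is not empty unless there are no columns at all, which
  -- excludes a final 0.
  sound-dec : ∀ j k (v : Vec ℕ m) w →
    After (just (dec , suc j)) (k ∷ v) (λ vs → Run (col j) vs w) →
    true ∷ w ≡ listUnary (lookup v j ∷ columnsFrom (suc j) v) × Positive (lookup v j ∷ columnsFrom (suc j) v)
  sound-col : ∀ w j k (v : Vec ℕ m) → Run (col j) (k ∷ v) w →
    w ≡ listUnary (lookup v j ∷ columnsFrom (suc j) v) × Positive (columnsFrom (suc j) v)
  sound-colGap : ∀ w ℓ k (v : Vec ℕ m) → Run (colGap ℓ) (k ∷ v) w →
    w ≡ listUnary (columnsFrom ℓ v) × Positive (columnsFrom ℓ v) × (m ≡ 0 ⊎ columnsFrom ℓ v ≢ [])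

  sound-dec j k v w run with lookup v j
  ... | suc x with sound-col w j k (v [ j ]≔ x) run
  ... | w≡ , v>0 rewrite Vec.lookup∘updateAt j {λ _ → x} v | columnsFrom-[]≔ j v x =
    cong (true ∷_) w≡ , s≤s z≤n ∷ v>0

  sound-col [] j k v (last , zero-last) with toWitness last | to (isZero-↔ (fromℕ m) (k ∷ v) (λ _ → ⊤)) zero-last
  ... | j-last | v≡0 , _
    rewrite trans (cong (lookup (k ∷ v)) j-last) v≡0 | trans (cong (λ ℓ → columnsFrom ℓ v) j-last) (columnsFrom-fromℕ v) =
    refl , []
  sound-col (true ∷ w) j k v (col j′ , ok , run) with toWitness ok
  ... | refl with sound-dec j k v w run
  ... | w≡ , _ ∷ v>0 = w≡ , v>0
  sound-col (false ∷ w) j k v (colGap ℓ , ok , run) with toWitness ok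
  ... | refl with to (isZero-↔ (suc j) (k ∷ v) (λ vs → Run (colGap (suc j)) vs w)) run
  ... | v≡0 , run′ with sound-colGap w (suc j) k (v [ j ]≔ 0) run′
  ... | w≡ , v>0 , nonempty rewrite v≡0 | columnsFrom-[]≔ j v 0 = continue (columnsFrom (suc j) v) w≡ v>0 nonempty
    where
    absent : ∀ {k} → Fin k → k ≢ 0
    absent () refl
    continue : ∀ bs → w ≡ listUnary bs → Positive bs → m ≡ 0 ⊎ bs ≢ [] →
               false ∷ w ≡ more bs × Positive bs
    continue bs       w≡ bs>0 (inj₁ m≡0) = contradiction m≡0 (absent j)
    continue []       w≡ bs>0 (inj₂ nonempty) = contradiction refl nonempty
    continue (b ∷ bs) w≡ bs>0 (inj₂ nonempty) = cong (false ∷_) w≡ , bs>0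

  sound-colGap [] ℓ k v (ok , _) with columnsFrom-empty ℓ v (toWitness ok)
    where
    columnsFrom-empty : ∀ {k} ℓ (v : Vec ℕ k) → k ≡ 0 → columnsFrom ℓ v ≡ []
    columnsFrom-empty zero [] refl = refl
  ... | eq rewrite eq = refl , [] , inj₁ (toWitness ok)
  sound-colGap (true ∷ w) ℓ k v (col j , ok , run) with toWitness ok
  ... | refl rewrite columnsFrom-inject₁ j v with sound-dec j k v w run
  ... | w≡ , v>0 = w≡ , v>0 , inj₂ λ ()

  sound-columns : ∀ w k u → Run (colGap zero) (k ∷ u) w → All (1 ≤_) u × w ≡ unary u
  sound-columns w k u run with sound-colGap w zero k u run
  ... | w≡ , u>0 , _ = All.toList⁻ u>0 , trans w≡ (sym (unary≡ u))

  -- The word w consists of positive row sums α and positive column sums β, written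
  -- as prescribed by written, and these have the same total once the column sums u
  -- of earlier rows are added to α.
  record Remaining (n : ℕ) (u : Vec ℕ m) (written : Vec ℕ n → Vec ℕ m → Word) (w : Word) : Set where
    constructor remaining
    field
      α         : Vec ℕ n
      β         : Vec ℕ m
      αPositive : All (1 ≤_) α
      βPositive : All (1 ≤_) β
      sameSum   : sum u + sum α ≡ sum β
      isWritten : w ≡ written α β

  rowsAndColumns : ∀ {n} → Vec ℕ n → Vec ℕ m → Word
  rowsAndColumns α β = blocks α (false ∷ unary β)

  sound-rowEnd : ∀ w n u → Run rowEnd (n ∷ u) w → Remaining n u rowsAndColumns w
  sound-row : ∀ w j n u → Run (row j) (n ∷ bump u j) w → Remaining n u rowsAndColumns (true ∷ w)

  sound-rowEnd (true ∷ w) n u (row j , _ , run) = sound-row w j n u run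
  sound-rowEnd (false ∷ w) zero u (colGap zero , _ , run) with sound-columns w 0 u run
  ... | u>0 , w≡ = remaining [] u [] u>0 (+-identityʳ (sum u)) (cong (false ∷_) w≡)

  sound-row (true ∷ w) j n u (row i , _ , run) with sound-row w i n (bump u j) run
  ... | remaining (suc a ∷ α) β (_ ∷ α>0) β>0 sums w≡ =
    remaining (suc (suc a) ∷ α) β (s≤s z≤n ∷ α>0) β>0 sums′ (cong (true ∷_) w≡)
    where
    sums′ : sum u + suc (suc a + sum α) ≡ sum β
    sums′ = trans (+-suc (sum u) _) (trans (cong (_+ sum (suc a ∷ α)) (sym (sum-bump u j))) sums)
  sound-row (false ∷ w) j (suc n) u (rowEnd , _ , run) with sound-rowEnd w n (bump u j) run
  ... | remaining α β α>0 β>0 sums w≡ =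
    remaining (1 ∷ α) β (s≤s z≤n ∷ α>0) β>0 sums′ (cong (λ w → true ∷ false ∷ w) w≡)
    where
    sums′ : sum u + suc (sum α) ≡ sum β
    sums′ = trans (+-suc (sum u) _) (trans (cong (_+ sum α) (sym (sum-bump u j))) sums)

  sound-rows : ∀ w n u → Run rows (n ∷ u) w →
    Remaining n u (λ α β → unary α ++ false ∷ false ∷ unary β) w
  sound-rows (true ∷ w) n u (row j , _ , run) with sound-row w j n u run
  ... | remaining (a ∷ α) β α>0 β>0 sums w≡ =
    remaining (a ∷ α) β α>0 β>0 sums (trans w≡ (sym (unary-blocks a α (false ∷ unary β))))
  sound-rows (false ∷ false ∷ w) zero u (noRows , _ , colGap zero , _ , run) with sound-columns w 0 u run
  ... | u>0 , w≡ = remaining [] u [] u>0 (+-identityʳ (sum u)) (cong (λ w → false ∷ false ∷ w) w≡)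

  sound-count : ∀ w k u → Run count (k ∷ u) w →
    ∃[ n ] ∃[ w′ ] w ≡ ones n ++ false ∷ false ∷ w′ × Run rows (n + k ∷ u) w′
  sound-count (false ∷ false ∷ w) k u (gap , _ , rows , _ , run) = 0 , w , refl , run
  sound-count (true ∷ w) k u (count , _ , run) with sound-count w (suc k) u run
  ... | n , w′ , w≡ , run′ =
    suc n , w′ , cong (true ∷_) w≡ , subst (λ k → Run rows (k ∷ u) w′) (+-suc n k) run′

  sound : ∀ w → Run count (replicate (suc m) 0) w → ∃[ M ] w ≡ encode {m} M
  sound w run with sound-count w 0 (replicate m 0) run
  ... | n , w′ , w≡ , run′
    with sound-rows w′ n _ (subst (λ k → Run rows (k ∷ replicate m 0) w′) (+-identityʳ n) run′)
  ... | remaining α β α>0 β>0 sums w′≡ =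
    record { α = α ; β = β ; αPositive = α>0 ; βPositive = β>0
           ; sameSum = trans (sym (cong (_+ sum α) (sum-0 m))) sums } ,
    trans w≡ (cong (λ w → ones n ++ false ∷ false ∷ w) w′≡)

-- Any family in bijection with the tables of a rule is counted by the accepting
-- runs of the corresponding automaton.
contingency-∈#L : ∀ ρ m (S : ∀ {n} → Vec ℕ n → Vec ℕ m → Set) →
  (∀ {n} (α : Vec ℕ n) (β : Vec ℕ m) → S α β ↔ Tables ρ (replicate m 0) α β) →
  ∃[ f ] Counts m S f × f ∈#L
contingency-∈#L ρ m S S↔Tables = accepted , counts , accepted∈#L
  where
  open Marginal ρ m
  open Compile automaton
  open CounterAutomaton automaton using (Run; finite-Run)

  counts : Counts m S accepted
  counts = record
    { onEncodings = λ M → proj₂ (finite-Run count (replicate (suc m) 0) (encode M)) ↔-∘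
        (↔-sym (run-encode-↔ M) ↔-∘ S↔Tables (Marginals.α M) (Marginals.β M))
    ; elsewhere = elsewhere
    }
    where
    elsewhere : ∀ x → (∀ M → x ≢ encode M) → accepted x ≡ 0
    elsewhere x x-malformed with finite-Run count (replicate (suc m) 0) x
    ... | zero  , _     = refl
    ... | suc k , run↔k = let (M , x≡) = sound x (Inverse.from run↔k zero) in contradiction x≡ (x-malformed M)

theorem4p5 : (m : ℕ) →
    (∃[ f ] Counts m CT f × f ∈#L) ×
    (∃[ f ] Counts m CT₀ f × f ∈#L)
theorem4p5 m = contingency-∈#L natural m CT (Contingency-↔ natural) , contingency-∈#L binary m CT₀ (Contingency-↔ binary)
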